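{- There exist exactly 16 values $\theta$, modulo 1, for which $D(\theta)=1+\frac{2}{\sqrt5}$. They are the classes modulo 1 of $\eta_i$ and $1-\eta_i$ for $i=1,\dots,8$, where $$\eta_1=\tfrac{13+\sqrt5}{82},\quad \eta_2=\tfrac{7-\sqrt5}{22},\quad \eta_3=\tfrac{11+\sqrt5}{58},\quad \eta_4=\tfrac{5-\sqrt5}{10},$$ $$\eta_5=\tfrac{9+\sqrt5}{38},\quad \eta_6=\tfrac{25-\sqrt5}{62},\quad \eta_7=\tfrac{3-\sqrt5}{2},\quad \eta_8=\tfrac{7+\sqrt5}{22}.$$
   Context: For $\theta\in\mathbb{R}$ and an integer $m\ge 0$, let $d_\theta(m)=\sup\{|I| : I\subset\mathbb{R}\text{ an interval},\ (I+\mathbb{Z})\cap\{0,\theta,2\theta,\dots,m\theta\}=\emptyset\}$, where $|I|$ is the length of $I$. Let $D(\theta)=\sup_{m\in\mathbb{N}}(m+1)\,d_\theta(m)$ (possibly $+\infty$), where $\mathbb{N}$ is the set of positive integers. -}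

module Defs where

open import Level using (Level; _⊔_) renaming (suc to lsuc)
open import Algebra.Apartness.Bundles using (HeytingField; HeytingCommutativeRing)
open import Algebra.Bundles using (CommutativeRing)
import Algebra.Definitions.RawMonoid as RawMonoid
import Algebra.Apartness.Properties.HeytingCommutativeRing as HeytingProperties
import Algebra.Properties.Ring as RingProperties
open import Data.Bool.Base using (Bool; true; false)
open import Data.Fin.Base using (Fin; splitAt)
open import Data.Fin.Patterns using (0F; 1F; 2F; 3F; 4F; 5F; 6F; 7F)
open import Data.Integer.Base using (ℤ; +_; -[1+_])
open import Data.Nat.Base as ℕ using (ℕ; zero; suc; NonZero)
open import Data.Product.Base using (∃; ∃-syntax; _×_; _,_; proj₁)
open import Data.Sum.Base using (_⊎_; inj₁; inj₂; [_,_])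
open import Relation.Binary.Core using (Rel)
open import Relation.Binary.Structures using (IsStrictPartialOrder)
open import Relation.Nullary.Negation using (¬_)
open import Relation.Unary using (Pred; _∈_)

-- The real numbers, axiomatised as a Cauchy-complete Archimedean ordered
-- field.  Classically this determines ℝ up to unique isomorphism; read
-- constructively, it is satisfied by the Cauchy reals, so no form of
-- excluded middle is built in (in particular, _<_ need not be decidable).
record RealNumbers (c ℓ₁ ℓ₂ ℓ₃ : Level) : Set (lsuc (c ⊔ ℓ₁ ⊔ ℓ₂ ⊔ ℓ₃)) where
  infix 4 _<_ _≤_
  field
    heytingField : HeytingField c ℓ₁ ℓ₂

  open HeytingField heytingField public
  open HeytingCommutativeRing heytingCommutativeRing public
    using (commutativeRing)

  open RawMonoid (CommutativeRing.+-rawMonoid commutativeRing) public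
    using () renaming (_×_ to _·_)

  fromℕ : ℕ → Carrier
  fromℕ n = n · 1#

  field
    _<_                  : Rel Carrier ℓ₃
    isStrictPartialOrder : IsStrictPartialOrder _≈_ _<_
    <⇒#                  : ∀ {x y} → x < y → x # y
    #⇒<⊎>                : ∀ {x y} → x # y → x < y ⊎ y < x
    +-monoˡ-<            : ∀ z {x y} → x < y → x + z < y + z
    *-pos                : ∀ {x y} → 0# < x → 0# < y → 0# < x * y
    archimedean          : ∀ x → ∃[ n ] x < fromℕ n

  -- In IsCauchy the bound on a m - a n is two-sided, as m and n may be swapped.
  IsCauchy : (ℕ → Carrier) → Set (c ⊔ ℓ₃)
  IsCauchy a = ∀ ε → 0# < ε →
    ∃[ N ] (∀ m n → N ℕ.≤ m → N ℕ.≤ n → a m - a n < ε)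

  ConvergesTo : (ℕ → Carrier) → Carrier → Set (c ⊔ ℓ₃)
  ConvergesTo a l = ∀ ε → 0# < ε →
    ∃[ N ] (∀ n → N ℕ.≤ n → (a n - l < ε) × (l - a n < ε))

  field
    complete : ∀ a → IsCauchy a → ∃[ l ] ConvergesTo a l

  fromℤ : ℤ → Carrier
  fromℤ (+ n)    = fromℕ n
  fromℤ -[1+ n ] = - fromℕ (suc n)

  _≤_ : Rel Carrier ℓ₃
  x ≤ y = ¬ (y < x)

  open IsStrictPartialOrder isStrictPartialOrder public
    using (<-resp-≈; <-respʳ-≈; <-respˡ-≈)
    renaming (irrefl to <-irrefl; trans to <-trans; asym to <-asym)

  private
    module CR = CommutativeRing commutativeRing
    module RP = RingProperties CR.ring

  0<1 : 0# < 1#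
  0<1 with #⇒<⊎> (HeytingProperties.1#0 heytingCommutativeRing)
  ... | inj₂ 0<1 = 0<1
  ... | inj₁ 1<0 = <-respʳ-≈ [-1]²≈1 (*-pos 0<-1 0<-1)
    where
    0<-1 : 0# < - 1#
    0<-1 = <-respˡ-≈ (-‿inverseʳ 1#)
             (<-respʳ-≈ (+-identityˡ (- 1#)) (+-monoˡ-< (- 1#) 1<0))

    [-1]²≈1 : - 1# * - 1# ≈ 1#
    [-1]²≈1 = trans (RP.-1*x≈-x (- 1#)) (RP.-‿involutive 1#)

  0<fromℕ : ∀ n .{{_ : NonZero n}} → 0# < fromℕ n
  0<fromℕ 1             = <-respʳ-≈ (sym (+-identityʳ 1#)) 0<1
  0<fromℕ (suc (suc n)) = <-trans (0<fromℕ (suc n))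
    (<-respˡ-≈ (+-identityˡ (fromℕ (suc n))) (+-monoˡ-< (fromℕ (suc n)) 0<1))

  -- #⇒invertible inverts y - 0#, which is equal to y.
  infixl 7 _÷_[_] _/_
  _÷_[_] : Carrier → ∀ y → 0# < y → Carrier
  x ÷ y [ 0<y ] = x * proj₁ (#⇒invertible (#-sym (<⇒# 0<y)))

  _/_ : Carrier → (n : ℕ) .{{_ : NonZero n}} → Carrier
  x / n = x ÷ fromℕ n [ 0<fromℕ n ]


module Dispersion {c ℓ₁ ℓ₂ ℓ₃} (ℝ : RealNumbers c ℓ₁ ℓ₂ ℓ₃) where
  open RealNumbers ℝ

  IsUpperBound : ∀ {p} → Pred Carrier p → Carrier → Set (c ⊔ ℓ₃ ⊔ p)
  IsUpperBound S u = ∀ x → x ∈ S → x ≤ u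

  IsSup : ∀ {p} → Pred Carrier p → Carrier → Set (c ⊔ ℓ₃ ⊔ p)
  IsSup S s = IsUpperBound S s × (∀ u → IsUpperBound S u → s ≤ u)

  -- Bounded intervals of each of the four kinds (open, closed, half-open),
  -- including degenerate and empty ones.  Unbounded intervals are omitted:
  -- they contain an integer, so they never avoid 0 modulo 1.
  record Interval : Set (c ⊔ ℓ₃) where
    field
      left right              : Carrier
      left≤right              : left ≤ right
      leftClosed rightClosed  : Bool

  open Interval

  _≤[_]_ : Carrier → Bool → Carrier → Set ℓ₃
  x ≤[ true  ] y = x ≤ y
  x ≤[ false ] y = x < y

  infix 4 _∈ᴵ_
  _∈ᴵ_ : Carrier → Interval → Set ℓ₃
  x ∈ᴵ I = (left I ≤[ leftClosed I ] x) × (x ≤[ rightClosed I ] right I)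

  ∣_∣ : Interval → Carrier
  ∣ I ∣ = right I - left I

  -- (I + ℤ) ∩ {0, θ, 2θ, …, mθ} = ∅
  Avoids : Carrier → ℕ → Interval → Set (c ⊔ ℓ₁ ⊔ ℓ₃)
  Avoids θ m I = ∀ x (k : ℤ) j → x ∈ᴵ I → j ℕ.≤ m → ¬ (x + fromℤ k ≈ j · θ)

  AvoidingLength : Carrier → ℕ → Pred Carrier (c ⊔ ℓ₁ ⊔ ℓ₃)
  AvoidingLength θ m l = ∃[ I ] Avoids θ m I × l ≈ ∣ I ∣

  -- d_θ(m) = d
  Is-d : Carrier → ℕ → Carrier → Set (c ⊔ ℓ₁ ⊔ ℓ₃)
  Is-d θ m d = IsSup (AvoidingLength θ m) d

  ScaledValue : Carrier → Pred Carrier (c ⊔ ℓ₁ ⊔ ℓ₃)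
  ScaledValue θ v =
    ∃[ m ] ∃[ d ] 1 ℕ.≤ m × Is-d θ m d × v ≈ suc m · d

  -- D(θ) = v for a finite v; when D(θ) = +∞ this holds for no v.
  Is-D : Carrier → Carrier → Set (c ⊔ ℓ₁ ⊔ ℓ₃)
  Is-D θ v = IsSup (ScaledValue θ) v

  infix 4 _≈₁_
  _≈₁_ : Rel Carrier ℓ₁
  x ≈₁ y = ∃[ k ] x ≈ y + fromℤ k

  -- η s i is η_{i+1}, with s standing for √5.
  η : Carrier → Fin 8 → Carrier
  η s 0F = (fromℕ 13 + s) / 82
  η s 1F = (fromℕ 7  - s) / 22
  η s 2F = (fromℕ 11 + s) / 58
  η s 3F = (fromℕ 5  - s) / 10
  η s 4F = (fromℕ 9  + s) / 38
  η s 5F = (fromℕ 25 - s) / 62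
  η s 6F = (fromℕ 3  - s) / 2
  η s 7F = (fromℕ 7  + s) / 22

  -- η_1, …, η_8, 1 - η_1, …, 1 - η_8
  extremal : Carrier → Fin 16 → Carrier
  extremal s j = [ η s , (λ i → 1# - η s i) ] (splitAt 8 j)

-- Let p / q < θ < p' / q' be Farey neighbours, δ = q θ − p and δ' = p' − q' θ, so that q δ' + q' δ = 1.  The longest
-- gap left by the N points 0, θ, …, (N − 1) θ modulo 1 is δ + δ' whenever max (q , q') ≤ N < q + q'.  Hence D(θ) is
-- the supremum of the values (q + q' − 1)(δ + δ') over the nodes on the path of θ in the Stern–Brocot tree.
--
-- If no value exceeds v = 1 + 2 / √5 < 19/10, then the path changes direction at every node with q + q' ≥ 20, which
-- forces the ratio of δ and δ' to be the golden ratio φ there.  A finite search through the possible beginnings of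
-- the path leaves 16 numbers.  Conversely, once δ = φ δ', each step multiplies q φ − q' by − 1 / φ, and
-- √5 (v − value) = δ' (√5 φ² − (q φ − q')); so all later values are at most v and they tend to v.
--
-- These arguments only ever refute something, so they may be read classically.  The integer part of θ and the index
-- of the extremal number are found at the end, by comparing θ with finitely many numbers that are pairwise apart.

module Submission where

open import Defs
open import Algebra.Bundles using (CommutativeRing)
import Algebra.Solver.Ring as RingSolver
open import Algebra.Solver.Ring.AlmostCommutativeRing using (fromCommutativeRing; _-Raw-AlmostCommutative⟶_)
open import Data.Bool.Base using (Bool; true; false; T; _∧_; _∨_)
open import Data.Bool.ListAction using (any)
open import Data.Bool.Properties using (T?)
open import Data.Empty using (⊥; ⊥-elim)
open import Data.Fin.Base as Fin using (Fin; splitAt; punchIn; punchOut)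
open import Data.Fin.Patterns using (0F; 1F; 2F; 3F; 4F; 5F; 6F; 7F)
import Data.Fin.Properties as Finₚ
open import Data.Integer.Base as ℤ using (ℤ; +_; -[1+_])
import Data.Integer.Properties as ℤₚ
open import Data.List.Base as List using (List; []; _∷_; map)
open import Data.List.Relation.Unary.All as All using (All; []; _∷_)
import Data.List.Relation.Unary.All.Properties as Allₚ
import Data.List.Relation.Unary.Any as Any
import Data.List.Relation.Unary.Any.Properties as Anyₚ
open import Data.Maybe.Base using (Maybe; just; nothing)
open import Data.Nat.Base as ℕ using (ℕ; zero; suc; NonZero; z≤n; s≤s)
import Data.Nat.Properties as ℕₚ
open import Data.Product.Base using (∃-syntax; _×_; _,_; proj₁; proj₂)
open import Data.Sum.Base using (_⊎_; inj₁; inj₂; fromInj₁; [_,_])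
open import Data.Unit.Base using (tt)
open import Data.Vec.Base as Vec using (Vec; []; _∷_; lookup)
import Data.Vec.Properties as Vecₚ
open import Function.Base using (_∘_)
open import Function.Bundles using (_⇔_; mk⇔)
open import Function.Definitions using (Injective)
open import Level using (_⊔_)
open import Relation.Binary.PropositionalEquality.Core as ≡ using (_≡_; _≢_)
open import Relation.Nullary using (¬_; yes; no)
open import Relation.Nullary.Decidable using (⌊_⌋; toWitness; decidable-stable)

-- Constructively a supremum need not exist, so `d_θ(m)` is only a relation. Estimates from above
-- are therefore proved for the length of each avoiding interval; estimates from below use only
-- those m at which the supremum is exhibited: m + 1 = q + q' - 1 at a node, or every large m when θ
-- is rational. In the rational case the gap stops shrinking and D(θ) = +∞.
--
-- The threshold 20 comes from Chebyshev's sum inequality. Up to exchange, a repeated direction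
-- means q ≤ q' and δ ≤ δ', so (q + q')(δ + δ') ≥ 2 (q δ' + q' δ) = 2 and the value is at least 2 -
-- 2 / (q + q'), whereas v = (3 + 4 φ) / 5 is about 1.894. In the finite search the values of
-- earlier nodes stay available as linear bounds in the current δ and δ'.
--
-- Inequalities are mostly proved by certificates: a sum of products of nonnegative terms equals the
-- desired difference modulo the relations between φ, v, δ and δ'. The finite case analyses are
-- Boolean tests on integers that the type checker evaluates.

-- Arithmetic of the ordered field, in the form used by certificates.

module OrderedField {c ℓ₁ ℓ₂ ℓ₃} (ℝ : RealNumbers c ℓ₁ ℓ₂ ℓ₃) where
  open RealNumbers ℝ public
  open CommutativeRing commutativeRing public using (ring; semiring)
  open import Algebra.Properties.Ring ring using (-0#≈0#; -‿distribˡ-*; -‿distribʳ-*; -‿involutive; -‿+-comm)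
  open import Algebra.Properties.Semiring.Mult semiring using (×-homo-+; ×1-homo-*)
  open import Relation.Binary.Reasoning.Setoid setoid

  fromℕ-+ : ∀ m n → fromℕ (m ℕ.+ n) ≈ fromℕ m + fromℕ n
  fromℕ-+ = ×-homo-+ 1#

  fromℕ-* : ∀ m n → fromℕ (m ℕ.* n) ≈ fromℕ m * fromℕ n
  fromℕ-* = ×1-homo-*

  cancel-1 : ∀ x y → x - y ≈ (1# + x) - (1# + y)
  cancel-1 x y = begin
    x - y                     ≈⟨ +-congʳ (+-identityʳ x) ⟨
    (x + 0#) - y              ≈⟨ +-congʳ (+-congˡ (-‿inverseʳ 1#)) ⟨
    (x + (1# - 1#)) - y       ≈⟨ +-congʳ (+-assoc x 1# (- 1#)) ⟨
    ((x + 1#) - 1#) - y       ≈⟨ +-assoc (x + 1#) (- 1#) (- y) ⟩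
    (x + 1#) + (- 1# - y)     ≈⟨ +-cong (+-comm x 1#) (-‿+-comm 1# y) ⟩
    (1# + x) - (1# + y)       ∎

  fromℤ-⊖ : ∀ m n → fromℤ (m ℤ.⊖ n) ≈ fromℕ m - fromℕ n
  fromℤ-⊖ zero    zero    = sym (-‿inverseʳ 0#)
  fromℤ-⊖ zero    (suc n) = sym (+-identityˡ _)
  fromℤ-⊖ (suc m) zero    = sym (trans (+-congˡ -0#≈0#) (+-identityʳ _))
  fromℤ-⊖ (suc m) (suc n) rewrite ℤₚ.[1+m]⊖[1+n]≡m⊖n m n =
    trans (fromℤ-⊖ m n) (cancel-1 (fromℕ m) (fromℕ n))

  fromℤ-neg : ∀ i → fromℤ (ℤ.- i) ≈ - fromℤ i
  fromℤ-neg (+ zero)  = sym -0#≈0#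
  fromℤ-neg (+ suc n) = refl
  fromℤ-neg -[1+ n ]  = sym (-‿involutive _)

  fromℤ-+ : ∀ i j → fromℤ (i ℤ.+ j) ≈ fromℤ i + fromℤ j
  fromℤ-+ (+ m)    (+ n)    = fromℕ-+ m n
  fromℤ-+ (+ m)    -[1+ n ] = fromℤ-⊖ m (suc n)
  fromℤ-+ -[1+ m ] (+ n)    = trans (fromℤ-⊖ n (suc m)) (+-comm _ _)
  fromℤ-+ -[1+ m ] -[1+ n ] = begin
    - fromℕ (suc (suc (m ℕ.+ n)))         ≡⟨ ≡.cong (λ k → - fromℕ (suc k)) (ℕₚ.+-suc m n) ⟨
    - fromℕ (suc m ℕ.+ suc n)             ≈⟨ -‿cong (fromℕ-+ (suc m) (suc n)) ⟩
    - (fromℕ (suc m) + fromℕ (suc n))     ≈⟨ -‿+-comm _ _ ⟨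
    - fromℕ (suc m) - fromℕ (suc n)       ∎

  fromℤ-*-+ : ∀ m j → fromℤ (+ m ℤ.* j) ≈ fromℕ m * fromℤ j
  fromℤ-*-+ m (+ n) rewrite ≡.sym (ℤₚ.pos-* m n) = fromℕ-* m n
  fromℤ-*-+ m -[1+ n ] rewrite ≡.sym (ℤₚ.neg-distribʳ-* (+ m) (+ suc n)) | ≡.sym (ℤₚ.pos-* m (suc n)) =
    trans (fromℤ-neg (+ (m ℕ.* suc n))) (trans (-‿cong (fromℕ-* m (suc n))) (-‿distribʳ-* _ _))

  fromℤ-* : ∀ i j → fromℤ (i ℤ.* j) ≈ fromℤ i * fromℤ j
  fromℤ-* (+ m)    j = fromℤ-*-+ m j
  fromℤ-* -[1+ m ] j rewrite ≡.sym (ℤₚ.neg-distribˡ-* (+ suc m) j) =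
    trans (fromℤ-neg (+ suc m ℤ.* j)) (trans (-‿cong (fromℤ-*-+ (suc m) j)) (-‿distribˡ-* _ _))

  private
    ℤ⟶ℝ : ℤ.+-*-rawRing -Raw-AlmostCommutative⟶ fromCommutativeRing commutativeRing
    ℤ⟶ℝ = record
      { ⟦_⟧    = fromℤ
      ; +-homo = fromℤ-+
      ; *-homo = fromℤ-*
      ; -‿homo = fromℤ-neg
      ; 0-homo = refl
      ; 1-homo = +-identityʳ 1#
      }

    _coeff≟_ : ∀ i j → Maybe (fromℤ i ≈ fromℤ j)
    i coeff≟ j with i ℤₚ.≟ j
    ... | yes ≡.refl = just refl
    ... | no _       = nothing

  module Solver = RingSolver ℤ.+-*-rawRing (fromCommutativeRing commutativeRing) ℤ⟶ℝ _coeff≟_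
  open Solver public using (solve; con; _:+_; _:*_; _:-_; :-_; _:=_)

  open import Algebra.Apartness.Properties.HeytingCommutativeRing heytingCommutativeRing using (invertibleˡ⇒#; x-0≈x) public

  private variable
    x y z a b k : Carrier

  <⇒0< : x < y → 0# < y - x
  <⇒0< {x} {y} x<y = <-respˡ-≈ (-‿inverseʳ x) (+-monoˡ-< (- x) x<y)

  0<⇒< : z ≈ y - x → 0# < z → x < y
  0<⇒< {z} {y} {x} z≈y-x 0<z = <-respˡ-≈ (+-identityˡ x) (<-respʳ-≈ (trans (+-congʳ z≈y-x) (solve 2 (λ y x → (y :- x) :+ x := y) refl y x)) (+-monoˡ-< x 0<z))

  <⇒≤ : x < y → x ≤ y
  <⇒≤ x<y y<x = <-asym x<y y<x

  ≤-reflexive : x ≈ y → x ≤ y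
  ≤-reflexive x≈y y<x = <-irrefl (sym x≈y) y<x

  ≤-refl : x ≤ x
  ≤-refl = ≤-reflexive refl

  <-cotrans : x < y → ∀ z → x < z ⊎ z < y
  <-cotrans x<y z with #-cotrans (<⇒# x<y) z
  ... | inj₁ x#z with #⇒<⊎> x#z
  ...   | inj₁ x<z = inj₁ x<z
  ...   | inj₂ z<x = inj₂ (<-trans z<x x<y)
  <-cotrans x<y z | inj₂ z#y with #⇒<⊎> z#y
  ...   | inj₁ z<y = inj₂ z<y
  ...   | inj₂ y<z = inj₁ (<-trans x<y y<z)

  <-≤-trans : x < y → y ≤ z → x < z
  <-≤-trans {z = z} x<y y≤z with <-cotrans x<y z
  ... | inj₁ x<z = x<z
  ... | inj₂ z<y = ⊥-elim (y≤z z<y)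

  ≤-<-trans : x ≤ y → y < z → x < z
  ≤-<-trans {x = x} x≤y y<z with <-cotrans y<z x
  ... | inj₁ y<x = ⊥-elim (x≤y y<x)
  ... | inj₂ x<z = x<z

  ≤-trans : x ≤ y → y ≤ z → x ≤ z
  ≤-trans x≤y y≤z z<x = x≤y (≤-<-trans y≤z z<x)

  ≤-respʳ-≈ : y ≈ z → x ≤ y → x ≤ z
  ≤-respʳ-≈ y≈z x≤y z<x = x≤y (<-respˡ-≈ (sym y≈z) z<x)

  ≤-respˡ-≈ : y ≈ z → y ≤ x → z ≤ x
  ≤-respˡ-≈ y≈z y≤x x<z = y≤x (<-respʳ-≈ (sym y≈z) x<z)

  ≤∧≥⇒≈ : x ≤ y → y ≤ x → x ≈ y
  ≤∧≥⇒≈ x≤y y≤x = proj₁ (tight _ _) λ x#y → [ y≤x , x≤y ] (#⇒<⊎> x#y)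

  -- Trichotomy for a goal that is a contradiction: the two outer cases refute both strict
  -- inequalities, and tightness then supplies the equality for the middle one.
  compare : (x < y → ⊥) → (x ≈ y → ⊥) → (y < x → ⊥) → ⊥
  compare y≤x x≉y x≤y = x≉y (≤∧≥⇒≈ x≤y y≤x)

  ≤⇒0≤ : x ≤ y → 0# ≤ y - x
  ≤⇒0≤ {x} {y} x≤y y-x<0 = x≤y (0<⇒< (solve 2 (λ x y → con (+ 0) :- (y :- x) := x :- y) refl x y) (<⇒0< y-x<0))

  0≤⇒≤ : z ≈ y - x → 0# ≤ z → x ≤ y
  0≤⇒≤ {z} {y} {x} z≈y-x 0≤z y<x = 0≤z (0<⇒< (trans (solve 2 (λ x y → x :- y := con (+ 0) :- (y :- x)) refl x y) (+-congˡ (-‿cong (sym z≈y-x)))) (<⇒0< y<x))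

  infixl 6 _+⁺⁺_ _+⁺⁰_ _+⁰⁰_
  infixl 7 _*⁺⁺_ _*⁰⁰_

  -- The superscripts record which arguments are positive and which only nonnegative, so that the
  -- proof of an inequality can be written like the expression whose sign it certifies.
  _+⁺⁺_ : 0# < x → 0# < y → 0# < x + y
  _+⁺⁺_ {x} {y} 0<x 0<y = <-trans 0<y (<-respˡ-≈ (+-identityˡ y) (+-monoˡ-< y 0<x))

  _+⁺⁰_ : 0# < x → 0# ≤ y → 0# < x + y
  _+⁺⁰_ {x} {y} 0<x 0≤y = ≤-<-trans 0≤y (<-respˡ-≈ (+-identityˡ y) (+-monoˡ-< y 0<x))

  _+⁰⁰_ : 0# ≤ x → 0# ≤ y → 0# ≤ x + y
  _+⁰⁰_ {x} {y} 0≤x 0≤y = ≤-trans 0≤y (0≤⇒≤ (solve 2 (λ x y → x := x :+ y :- y) refl x y) 0≤x)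

  _*⁺⁺_ : 0# < x → 0# < y → 0# < x * y
  _*⁺⁺_ = *-pos

  _*⁰⁰_ : 0# ≤ x → 0# ≤ y → 0# ≤ x * y
  _*⁰⁰_ {x} {y} 0≤x 0≤y xy<0 = compare {0#} {x}
    (λ 0<x → compare {0#} {y}
      (λ 0<y → <-asym xy<0 (0<x *⁺⁺ 0<y))
      (λ 0≈y → <-irrefl (trans (*-congˡ (sym 0≈y)) (zeroʳ x)) xy<0)
      0≤y)
    (λ 0≈x → <-irrefl (trans (*-congʳ (sym 0≈x)) (zeroˡ y)) xy<0)
    0≤x

  -- Closes a certificate of infeasibility: the hypotheses, weighted by suitable multipliers, add up
  -- to something positive that is identically zero.
  absurd : 0# < x → x ≈ 0# → ⊥
  absurd 0<x x≈0 = <-irrefl (sym x≈0) 0<x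

  square≈0 : ¬ (0# < x * x) → x ≈ 0#
  square≈0 {x} x²≤0 = ≤∧≥⇒≈ (λ 0<x → x²≤0 (0<x *⁺⁺ 0<x))
    (λ x<0 → x²≤0 (<-respʳ-≈ (solve 1 (λ x → (con (+ 0) :- x) :* (con (+ 0) :- x) := x :* x) refl x) (<⇒0< x<0 *⁺⁺ <⇒0< x<0)))

  0≤square : ∀ x → 0# ≤ x * x
  0≤square x x²<0 = <-irrefl (trans (*-cong x≈0 x≈0) (zeroˡ 0#)) x²<0
    where
    x≈0 : x ≈ 0#
    x≈0 = square≈0 (<-asym x²<0)

  -- The ring solver proves only identities that hold in every commutative ring. A hypothesis
  -- `a ≈ b` is brought in by naming the cofactor `k` of `a - b`, as in ideal membership; nested
  -- uses handle several relations.
  modulo : a ≈ b → x ≈ y + k * (a - b) → x ≈ y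
  modulo {a} {b} {x} {y} {k} a≈b x≈y+ = begin
    x                ≈⟨ x≈y+ ⟩
    y + k * (a - b)  ≈⟨ +-congˡ (*-congˡ (+-congʳ a≈b)) ⟩
    y + k * (b - b)  ≈⟨ solve 3 (λ y k b → y :+ k :* (b :- b) := y) refl y k b ⟩
    y                ∎

  -- `fromℕ 1` unfolds to `1# + 0#`. Numerals are written with `fromℕ`, the number one included,
  -- because that is how the solver reads its integer constants.
  fromℕ-1 : fromℕ 1 ≈ 1#
  fromℕ-1 = +-identityʳ 1#

  inverse : 0# < x → ∃[ y ] (0# < y × x * y ≈ fromℕ 1)
  inverse {x} 0<x with #⇒invertible (#-sym (<⇒# 0<x))
  ... | y , y*x≈1 , x*y≈1 = y , 0<y , trans xy≈1 (sym fromℕ-1)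
    where
    xy≈1 : x * y ≈ 1#
    xy≈1 = trans (*-congʳ (sym (x-0≈x x))) x*y≈1
    y#0 : y # 0#
    y#0 = invertibleˡ⇒# (x , trans (*-congˡ (x-0≈x y)) xy≈1)
    0<y : 0# < y
    0<y with #⇒<⊎> y#0
    ... | inj₂ 0<y = 0<y
    ... | inj₁ y<0 = ⊥-elim (absurd (0<x *⁺⁺ <⇒0< y<0 +⁺⁺ 0<fromℕ 1)
      (modulo {k = - fromℕ 1} (trans xy≈1 (sym fromℕ-1)) (solve 2 (λ x y → x :* (con (+ 0) :- y) :+ con (+ 1) := con (+ 0) :+ (:- con (+ 1)) :* (x :* y :- con (+ 1))) refl x y)))

  0<-cancelˡ : 0# < a → 0# < a * x → 0# < x
  0<-cancelˡ {a} {x} 0<a 0<ax with inverse 0<a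
  ... | b , 0<b , ab≈1 = <-respʳ-≈ (modulo {k = x} ab≈1 (solve 3 (λ a b x → b :* (a :* x) := x :+ x :* (a :* b :- con (+ 1))) refl a b x)) (0<b *⁺⁺ 0<ax)

  0≤-cancelˡ : 0# < a → 0# ≤ a * x → 0# ≤ x
  0≤-cancelˡ {a} {x} 0<a 0≤ax x<0 = 0≤ax (0<⇒< (solve 2 (λ a x → a :* (con (+ 0) :- x) := con (+ 0) :- a :* x) refl a x) (0<a *⁺⁺ <⇒0< x<0))

  ≈-cancelˡ : 0# < a → a * x ≈ a * y → x ≈ y
  ≈-cancelˡ {a} {x} {y} 0<a ax≈ay with inverse 0<a
  ... | b , _ , ab≈1 = begin
    x            ≈⟨ expand x ⟨
    b * (a * x)  ≈⟨ *-congˡ ax≈ay ⟩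
    b * (a * y)  ≈⟨ expand y ⟩
    y            ∎
    where
    expand : ∀ x → b * (a * x) ≈ x
    expand x = modulo {k = x} ab≈1 (solve 3 (λ a b x → b :* (a :* x) := x :+ x :* (a :* b :- con (+ 1))) refl a b x)

  archimedean* : 0# < a → ∀ x → ∃[ n ] x < fromℕ n * a
  archimedean* {a} 0<a x with inverse 0<a
  ... | b , 0<b , ab≈1 with archimedean (b * x)
  ...   | n , bx<n = n , 0<⇒< (modulo {k = - x} ab≈1 (solve 4 (λ a b x n → a :* (n :- b :* x) := n :* a :- x :+ (:- x) :* (a :* b :- con (+ 1))) refl a b x (fromℕ n))) (0<a *⁺⁺ <⇒0< bx<n)

  0≤fromℕ : ∀ n → 0# ≤ fromℕ n
  0≤fromℕ zero    = ≤-refl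
  0≤fromℕ (suc n) = <⇒≤ (0<fromℕ (suc n))

  fromℕ-mono : ∀ {m n} → m ℕ.≤ n → fromℕ m ≤ fromℕ n
  fromℕ-mono {m} {n} m≤n = 0≤⇒≤ eq (0≤fromℕ (n ℕ.∸ m))
    where
    eq : fromℕ (n ℕ.∸ m) ≈ fromℕ n - fromℕ m
    eq = trans (solve 2 (λ d m → d := m :+ d :- m) refl _ (fromℕ m))
      (+-congʳ (trans (sym (fromℕ-+ m (n ℕ.∸ m))) (reflexive (≡.cong fromℕ (ℕₚ.m+[n∸m]≡n m≤n)))))

  fromℤ-dichotomy : ∀ i → fromℤ i ≤ 0# ⊎ fromℕ 1 ≤ fromℤ i
  fromℤ-dichotomy (+ zero)  = inj₁ ≤-refl
  fromℤ-dichotomy (+ suc n) = inj₂ (fromℕ-mono {1} {suc n} (s≤s z≤n))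
  fromℤ-dichotomy -[1+ n ]  = inj₁ (<⇒≤ (0<⇒< (solve 1 (λ m → m := con (+ 0) :- :- m) refl _) (0<fromℕ (suc n))))

  fromℕ-· : ∀ n x → n · x ≈ fromℕ n * x
  fromℕ-· zero    x = sym (zeroˡ x)
  fromℕ-· (suc n) x = trans (+-congˡ (fromℕ-· n x)) (sym (trans (distribʳ x 1# (fromℕ n)) (+-congʳ (*-identityˡ x))))

-- The longest gap left by an orbit on the circle.

module LargestGap {c ℓ₁ ℓ₂ ℓ₃} (ℝ : RealNumbers c ℓ₁ ℓ₂ ℓ₃) where
  open OrderedField ℝ
  open Dispersion ℝ public
  open Interval

  private variable
    θ θ' δ δ' μ g : Carrier
    m : ℕ

  Avoids-shift : ∀ {k I} → θ ≈ θ' + fromℤ k → Avoids θ m I → Avoids θ' m I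
  Avoids-shift {θ} {θ'} {k = k} θ≈θ'+k avoids x i j x∈I j≤m x+i≈jθ' =
    avoids x (i ℤ.+ + j ℤ.* k) j x∈I j≤m (begin
      x + fromℤ (i ℤ.+ + j ℤ.* k)               ≈⟨ +-congˡ (trans (fromℤ-+ i _) (+-congˡ (fromℤ-* (+ j) k))) ⟩
      x + (fromℤ i + fromℕ j * fromℤ k)         ≈⟨ +-assoc x _ _ ⟨
      x + fromℤ i + fromℕ j * fromℤ k           ≈⟨ +-congʳ (trans x+i≈jθ' (fromℕ-· j θ')) ⟩
      fromℕ j * θ' + fromℕ j * fromℤ k          ≈⟨ distribˡ _ θ' _ ⟨
      fromℕ j * (θ' + fromℤ k)                  ≈⟨ *-congˡ θ≈θ'+k ⟨
      fromℕ j * θ                               ≈⟨ fromℕ-· j θ ⟨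
      j · θ                                     ∎)
    where open import Relation.Binary.Reasoning.Setoid setoid

  shift-back : ∀ {k} → θ ≈ θ' + fromℤ k → θ' ≈ θ + fromℤ (ℤ.- k)
  shift-back {θ' = θ'} {k = k} θ≈ = trans (solve 2 (λ θ' k → θ' := θ' :+ k :- k) refl θ' (fromℤ k)) (+-cong (sym θ≈) (sym (fromℤ-neg k)))

  Is-d-shift : ∀ {k d} → θ ≈ θ' + fromℤ k → Is-d θ m d → Is-d θ' m d
  Is-d-shift {θ} {θ'} {k = k} θ≈θ'+k (bound , least) =
      (λ l (I , avoids , l≈) → bound l (I , Avoids-shift {k = ℤ.- k} {I = I} θ'≈θ-k avoids , l≈))
    , (λ u bound' → least u λ l (I , avoids , l≈) → bound' l (I , Avoids-shift {k = k} {I = I} θ≈θ'+k avoids , l≈))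
    where
    θ'≈θ-k : θ' ≈ θ + fromℤ (ℤ.- k)
    θ'≈θ-k = shift-back {k = k} θ≈θ'+k

  point : Carrier → ℕ → ℤ → Carrier
  point θ j k = fromℕ j * θ - fromℤ k

  -- If every point of the orbit has another one at most g to its right, then so has the left end of the interval.
  cover : ∀ {I} → 0# < μ →
    (∀ j k → j ℕ.≤ m → ∃[ j' ] ∃[ k' ] j' ℕ.≤ m × μ ≤ point θ j' k' - point θ j k × point θ j' k' - point θ j k ≤ g) →
    Avoids θ m I → ∣ I ∣ ≤ g
  cover {μ} {m} {θ} {g} {I} 0<μ next avoids g<∣I∣ = overtaken (climb (proj₁ bound))
    where
    n : ℕ
    n = proj₁ (archimedean (- left I))
    -L<n : - left I < fromℕ n
    -L<n = proj₂ (archimedean (- left I))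
    bound : ∃[ t ] left I + fromℕ n < fromℕ t * μ
    bound = archimedean* 0<μ (left I + fromℕ n)
    -- These are `t` jumps along the orbit, starting from the integer -n to the left of `I`. A jump
    -- cannot pass the left end, since with a length of at most `g` < |I| it would land inside `I`.
    -- The uniform lower bound `μ` on the jumps makes this impossible for large `t`.
    climb : ∀ t → ∃[ j ] ∃[ k ] j ℕ.≤ m × point θ j k ≤ left I × fromℕ t * μ - fromℕ n ≤ point θ j k
    climb zero = 0 , + n , z≤n
      , <⇒≤ (0<⇒< (solve 3 (λ L n θ → n :- :- L := L :- (con (+ 0) :* θ :- n)) refl (left I) (fromℕ n) θ) (<⇒0< -L<n))
      , ≤-reflexive (solve 3 (λ μ n θ → con (+ 0) :* μ :- n := con (+ 0) :* θ :- n) refl μ (fromℕ n) θ)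
    climb (suc t) with climb t
    ... | j , k , j≤m , x≤L , above with next j k j≤m
    ...   | j' , k' , j'≤m , μ≤ , ≤g = j' , k' , j'≤m , y≤L
      , 0≤⇒≤ (trans (solve 6 (λ o t μ n x y → (x :- (t :* μ :- n)) :+ (y :- x :- μ) := y :- (t :* μ :+ μ :- n)) refl 1# (fromℕ t) μ (fromℕ n) (point θ j k) y)
                 (+-congˡ (-‿cong (+-congʳ (sym suc-μ)))))
          (≤⇒0≤ above +⁰⁰ ≤⇒0≤ μ≤)
      where
      y = point θ j' k'
      suc-μ : fromℕ (suc t) * μ ≈ fromℕ t * μ + μ
      suc-μ = trans (distribʳ μ 1# (fromℕ t)) (trans (+-congʳ (*-identityˡ μ)) (+-comm _ _))
      in-left : ∀ b → left I < y → left I ≤[ b ] y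
      in-left true  = <⇒≤
      in-left false L<y = L<y
      in-right : ∀ b → y < right I → y ≤[ b ] right I
      in-right true  = <⇒≤
      in-right false y<R = y<R
      y≤L : y ≤ left I
      y≤L L<y = avoids y k' j' (in-left (leftClosed I) L<y , in-right (rightClosed I) y<R) j'≤m
          (trans (solve 3 (λ j θ k → j :* θ :- k :+ k := j :* θ) refl (fromℕ j') θ (fromℤ k')) (sym (fromℕ-· j' θ)))
        where
        y<R : y < right I
        y<R = 0<⇒< (solve 5 (λ L R g x y → (R :- L :- g) :+ (L :- x) :+ (g :- (y :- x)) := R :- y) refl (left I) (right I) g (point θ j k) y)
          (<⇒0< g<∣I∣ +⁺⁰ ≤⇒0≤ x≤L +⁺⁰ ≤⇒0≤ ≤g)
    overtaken : ∃[ j ] ∃[ k ] j ℕ.≤ m × point θ j k ≤ left I × fromℕ (proj₁ bound) * μ - fromℕ n ≤ point θ j k → ⊥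
    overtaken (j , k , _ , x≤L , above) = absurd (<⇒0< (proj₂ bound) +⁺⁰ ≤⇒0≤ above +⁺⁰ ≤⇒0≤ x≤L)
      (solve 4 (λ L n s x → (s :- (L :+ n)) :+ (x :- (s :- n)) :+ (L :- x) := con (+ 0)) refl (left I) (fromℕ n) (fromℕ (proj₁ bound) * μ) (point θ j k))

  -- The signs of `δ` and `δ'` are left open: a rational θ reaches δ = 0, and the walk along the
  -- path of a given surd learns the signs only at its end.
  record FareyPair (θ : Carrier) (p q p' q' : ℕ) (δ δ' : Carrier) : Set ℓ₁ where
    field
      1≤q  : 1 ℕ.≤ q
      1≤q' : 1 ℕ.≤ q'
      det  : fromℕ p' * fromℕ q - fromℕ p * fromℕ q' ≈ fromℕ 1
      δ≈   : δ ≈ fromℕ q * θ - fromℕ p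
      δ'≈  : δ' ≈ fromℕ p' - fromℕ q' * θ

    unit : fromℕ q * δ' + fromℕ q' * δ ≈ fromℕ 1
    unit = trans (+-cong (*-congˡ δ'≈) (*-congˡ δ≈)) (trans
      (solve 5 (λ θ p q p' q' → q :* (p' :- q' :* θ) :+ q' :* (q :* θ :- p) := p' :* q :- p :* q') refl θ (fromℕ p) (fromℕ q) (fromℕ p') (fromℕ q'))
      det)

  module _ {θ : Carrier} {p q p' q' : ℕ} {δ δ' : Carrier} (pair : FareyPair θ p q p' q' δ δ') where
    open FareyPair pair

    private
      fromℤ-sub : ∀ i n → fromℤ (i ℤ.- + n) ≈ fromℤ i - fromℕ n
      fromℤ-sub i n = trans (fromℤ-+ i (ℤ.- + n)) (+-congˡ (fromℤ-neg (+ n)))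

      Step : ℕ → ℕ → ℤ → Set (ℓ₁)
      Step m j k = ∃[ j' ] ∃[ k' ] j' ℕ.≤ m ×
        (point θ j' k' - point θ j k ≈ δ' ⊎ ¬ (q' ℕ.≤ q) × point θ j' k' - point θ j k ≈ δ ⊎ point θ j' k' - point θ j k ≈ δ + δ')

      -- These are the three jumps of the three-distance theorem, to the indices j - q', j + q - q'
      -- and j + q. The last is taken only if j + q < q', and this is recorded: for rational θ it
      -- would have length δ = 0, but there q' ≤ q excludes it.
      step : q ℕ.≤ suc m → q' ℕ.≤ suc m → ∀ j k → j ℕ.≤ m → Step m j k
      step q≤N q'≤N j k j≤m with q' ℕₚ.≤? j
      ... | yes q'≤j = j ℕ.∸ q' , k ℤ.- + p' , ℕₚ.≤-trans (ℕₚ.m∸n≤m j q') j≤m , inj₁ (begin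
        fromℕ i * θ - fromℤ (k ℤ.- + p') - (fromℕ j * θ - fromℤ k)
          ≈⟨ +-cong (+-congˡ (-‿cong (fromℤ-sub k p'))) (-‿cong (+-congʳ (*-congʳ j≈))) ⟩
        fromℕ i * θ - (fromℤ k - fromℕ p') - ((fromℕ i + fromℕ q') * θ - fromℤ k)
          ≈⟨ solve 5 (λ i θ k p' q' → i :* θ :- (k :- p') :- ((i :+ q') :* θ :- k) := p' :- q' :* θ) refl (fromℕ i) θ (fromℤ k) (fromℕ p') (fromℕ q') ⟩
        fromℕ p' - fromℕ q' * θ ≈⟨ δ'≈ ⟨
        δ' ∎)
        where
        open import Relation.Binary.Reasoning.Setoid setoid
        i = j ℕ.∸ q'
        j≈ : fromℕ j ≈ fromℕ i + fromℕ q'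
        j≈ = trans (reflexive (≡.cong fromℕ (≡.sym (ℕₚ.m∸n+n≡m q'≤j)))) (fromℕ-+ i q')
      ... | no q'≰j with q' ℕₚ.≤? j ℕ.+ q
      ...   | yes q'≤j+q = i , k ℤ.+ + p ℤ.- + p' , ℕₚ.≤-pred (ℕₚ.≤-trans (ℕₚ.+-cancelʳ-< q' i q i+q'<q+q') q≤N) , inj₂ (inj₂ (begin
        fromℕ i * θ - fromℤ (k ℤ.+ + p ℤ.- + p') - (fromℕ j * θ - fromℤ k)
          ≈⟨ +-cong (+-congˡ (-‿cong (trans (fromℤ-sub (k ℤ.+ + p) p') (+-congʳ (fromℤ-+ k (+ p)))))) (-‿cong (+-congʳ (*-congʳ j≈))) ⟩
        fromℕ i * θ - (fromℤ k + fromℕ p - fromℕ p') - ((fromℕ i + fromℕ q' - fromℕ q) * θ - fromℤ k)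
          ≈⟨ solve 7 (λ i θ k p p' q q' → i :* θ :- (k :+ p :- p') :- ((i :+ q' :- q) :* θ :- k) := (q :* θ :- p) :+ (p' :- q' :* θ)) refl
               (fromℕ i) θ (fromℤ k) (fromℕ p) (fromℕ p') (fromℕ q) (fromℕ q') ⟩
        (fromℕ q * θ - fromℕ p) + (fromℕ p' - fromℕ q' * θ) ≈⟨ +-cong δ≈ δ'≈ ⟨
        δ + δ' ∎))
        where
        open import Relation.Binary.Reasoning.Setoid setoid
        i = j ℕ.+ q ℕ.∸ q'
        i+q'≡ : i ℕ.+ q' ≡ j ℕ.+ q
        i+q'≡ = ℕₚ.m∸n+n≡m q'≤j+q
        i+q'<q+q' : i ℕ.+ q' ℕ.< q ℕ.+ q'
        i+q'<q+q' rewrite i+q'≡ | ℕₚ.+-comm j q = ℕₚ.+-monoʳ-< q (ℕₚ.≰⇒> q'≰j)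
        j≈ : fromℕ j ≈ fromℕ i + fromℕ q' - fromℕ q
        j≈ = trans (solve 2 (λ j q → j := j :+ q :- q) refl (fromℕ j) (fromℕ q))
          (+-congʳ (trans (sym (fromℕ-+ j q)) (trans (reflexive (≡.cong fromℕ (≡.sym i+q'≡))) (fromℕ-+ i q'))))
      ...   | no q'≰j+q = j ℕ.+ q , k ℤ.+ + p , ℕₚ.≤-pred (ℕₚ.≤-trans (ℕₚ.≰⇒> q'≰j+q) q'≤N) , inj₂ (inj₁ ((λ q'≤q → q'≰j+q (ℕₚ.≤-trans q'≤q (ℕₚ.m≤n+m q j))) , (begin
        fromℕ (j ℕ.+ q) * θ - fromℤ (k ℤ.+ + p) - (fromℕ j * θ - fromℤ k)
          ≈⟨ +-congʳ (+-cong (*-congʳ (fromℕ-+ j q)) (-‿cong (fromℤ-+ k (+ p)))) ⟩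
        (fromℕ j + fromℕ q) * θ - (fromℤ k + fromℕ p) - (fromℕ j * θ - fromℤ k)
          ≈⟨ solve 5 (λ j θ k p q → (j :+ q) :* θ :- (k :+ p) :- (j :* θ :- k) := q :* θ :- p) refl (fromℕ j) θ (fromℤ k) (fromℕ p) (fromℕ q) ⟩
        fromℕ q * θ - fromℕ p ≈⟨ δ≈ ⟨
        δ ∎)))
        where open import Relation.Binary.Reasoning.Setoid setoid

      length≤ : ∀ {I} → 0# < μ → μ ≤ δ' → (μ ≤ δ ⊎ q' ℕ.≤ q) → 0# ≤ δ →
        q ℕ.≤ suc m → q' ℕ.≤ suc m → Avoids θ m I → ∣ I ∣ ≤ δ + δ'
      length≤ {μ} {m} {I} 0<μ μ≤δ' μ≤δ⊎q'≤q 0≤δ q≤N q'≤N = cover {I = I} 0<μ next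
        where
        0≤δ' : 0# ≤ δ'
        0≤δ' = ≤-trans (<⇒≤ 0<μ) μ≤δ'
        δ≤δ+δ' : δ ≤ δ + δ'
        δ≤δ+δ' = 0≤⇒≤ (solve 2 (λ δ δ' → δ' := δ :+ δ' :- δ) refl δ δ') 0≤δ'
        δ'≤δ+δ' : δ' ≤ δ + δ'
        δ'≤δ+δ' = 0≤⇒≤ (solve 2 (λ δ δ' → δ := δ :+ δ' :- δ') refl δ δ') 0≤δ
        next : ∀ j k → j ℕ.≤ m → ∃[ j' ] ∃[ k' ] j' ℕ.≤ m × μ ≤ point θ j' k' - point θ j k × point θ j' k' - point θ j k ≤ δ + δ'
        next j k j≤m with step q≤N q'≤N j k j≤m
        ... | j' , k' , j'≤m , inj₁ eq = j' , k' , j'≤m , ≤-respʳ-≈ (sym eq) μ≤δ' , ≤-respˡ-≈ (sym eq) δ'≤δ+δ'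
        ... | j' , k' , j'≤m , inj₂ (inj₂ eq) = j' , k' , j'≤m , ≤-respʳ-≈ (sym eq) (≤-trans μ≤δ' δ'≤δ+δ') , ≤-reflexive eq
        ... | j' , k' , j'≤m , inj₂ (inj₁ (q'≰q , eq)) = j' , k' , j'≤m , ≤-respʳ-≈ (sym eq) (fromInj₁ (λ q'≤q → ⊥-elim (q'≰q q'≤q)) μ≤δ⊎q'≤q) , ≤-respˡ-≈ (sym eq) δ≤δ+δ'

    -- The conclusion is a negation, so the smaller of `δ` and `δ'` may be picked by `compare` to
    -- serve as the least length of a jump.
    gap≤ : ∀ {I} → 0# < δ → 0# < δ' → q ℕ.≤ suc m → q' ℕ.≤ suc m → Avoids θ m I → ∣ I ∣ ≤ δ + δ'
    gap≤ {m} {I} 0<δ 0<δ' q≤N q'≤N avoids δ+δ'<∣I∣ = compare {δ} {δ'}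
      (λ δ<δ' → length≤ {μ = δ} {I = I} 0<δ (<⇒≤ δ<δ') (inj₁ ≤-refl) (<⇒≤ 0<δ) q≤N q'≤N avoids δ+δ'<∣I∣)
      (λ δ≈δ' → length≤ {μ = δ} {I = I} 0<δ (≤-reflexive δ≈δ') (inj₁ ≤-refl) (<⇒≤ 0<δ) q≤N q'≤N avoids δ+δ'<∣I∣)
      (λ δ'<δ → length≤ {μ = δ'} {I = I} 0<δ' ≤-refl (inj₁ (<⇒≤ δ'<δ)) (<⇒≤ 0<δ) q≤N q'≤N avoids δ+δ'<∣I∣)

    gap≤-rational : ∀ {I} → δ ≈ 0# → 0# < δ' → q' ℕ.≤ q → q ℕ.≤ suc m → Avoids θ m I → ∣ I ∣ ≤ δ + δ'
    gap≤-rational {I = I} δ≈0 0<δ' q'≤q q≤N = length≤ {I = I} 0<δ' ≤-refl (inj₂ q'≤q) (≤-reflexive (sym δ≈0)) q≤N (ℕₚ.≤-trans q'≤q q≤N)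

    module _ (0≤δ : 0# ≤ δ) (0≤δ' : 0# ≤ δ') where

      private
        L R : Carrier
        L = (fromℕ q' - fromℕ 1) * θ + fromℕ p
        R = (fromℕ q - fromℕ 1) * θ + fromℕ p'

        R-L≈ : R - L ≈ δ + δ'
        R-L≈ = trans (solve 5 (λ θ p q p' q' → ((q :- con (+ 1)) :* θ :+ p') :- ((q' :- con (+ 1)) :* θ :+ p) := (q :* θ :- p) :+ (p' :- q' :* θ)) refl
                 θ (fromℕ p) (fromℕ q) (fromℕ p') (fromℕ q')) (sym (+-cong δ≈ δ'≈))

      -- Modulo 1, its ends are the points of index q' - 1 and q - 1: the jump of length δ + δ' that
      -- `step` makes from j = q' - 1.
      gap : Interval
      gap = record { left = L ; right = R ; left≤right = 0≤⇒≤ (sym R-L≈) (0≤δ +⁰⁰ 0≤δ') ; leftClosed = false ; rightClosed = false }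

      ∣gap∣≈ : ∣ gap ∣ ≈ δ + δ'
      ∣gap∣≈ = R-L≈

      -- A point of the orbit at offset i θ + l from the left end has offset A δ + B δ' with integers A and B, because
      -- (q , − p), (− q' , p') is a basis of ℤ²; the signs of A and B then contradict either 0 < A δ + B δ' < δ + δ' or
      -- − q' < i = A q − B q' < q.
      gap-avoids : suc m ℕ.< q ℕ.+ q' ⊎ δ ≈ 0# → Avoids θ m gap
      gap-avoids {m} small x k j (L<x , x<R) j≤m x+k≈jθ = cases (fromℤ-dichotomy a) (fromℤ-dichotomy b) small
        where
        open import Relation.Binary.Reasoning.Setoid setoid
        a b i l : ℤ
        i = + j ℤ.- + q' ℤ.+ + 1
        l = ℤ.- k ℤ.- + p
        a = i ℤ.* + p' ℤ.+ l ℤ.* + q'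
        b = i ℤ.* + p ℤ.+ l ℤ.* + q
        J K P Q P' Q' A B : Carrier
        J = fromℕ j
        K = fromℤ k
        P = fromℕ p
        Q = fromℕ q
        P' = fromℕ p'
        Q' = fromℕ q'
        A = fromℤ a
        B = fromℤ b
        lincomb : ∀ u v → fromℤ (i ℤ.* + u ℤ.+ l ℤ.* + v) ≈ (J - Q' + fromℕ 1) * fromℕ u + (- K - P) * fromℕ v
        lincomb u v = trans (fromℤ-+ (i ℤ.* + u) (l ℤ.* + v)) (+-cong
          (trans (fromℤ-* i (+ u)) (*-congʳ (trans (fromℤ-+ (+ j ℤ.- + q') (+ 1)) (+-congʳ (fromℤ-sub (+ j) q')))))
          (trans (fromℤ-* l (+ v)) (*-congʳ (trans (fromℤ-sub (ℤ.- k) p) (+-congʳ (fromℤ-neg k))))))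
        x≈ : x ≈ J * θ - K
        x≈ = trans (solve 2 (λ x k → x := x :+ k :- k) refl x K) (+-congʳ (trans x+k≈jθ (fromℕ-· j θ)))
        x-L≈ : x - L ≈ A * δ + B * δ'
        x-L≈ = sym (begin
          A * δ + B * δ'
            ≈⟨ +-cong (*-cong (lincomb p' q') δ≈) (*-cong (lincomb p q) δ'≈) ⟩
          ((J - Q' + fromℕ 1) * P' + (- K - P) * Q') * (Q * θ - P) + ((J - Q' + fromℕ 1) * P + (- K - P) * Q) * (P' - Q' * θ)
            ≈⟨ modulo {k = (J - Q' + fromℕ 1) * θ + (- K - P)} det
                 (solve 7 (λ J K θ P Q P' Q' → ((J :- Q' :+ con (+ 1)) :* P' :+ (:- K :- P) :* Q') :* (Q :* θ :- P) :+ ((J :- Q' :+ con (+ 1)) :* P :+ (:- K :- P) :* Q) :* (P' :- Q' :* θ)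
                   := ((J :* θ :- K) :- ((Q' :- con (+ 1)) :* θ :+ P)) :+ ((J :- Q' :+ con (+ 1)) :* θ :+ (:- K :- P)) :* (P' :* Q :- P :* Q' :- con (+ 1)))
                   refl J K θ P Q P' Q') ⟩
          (J * θ - K) - L ≈⟨ +-congʳ x≈ ⟨
          x - L ∎)
        i≈ : A * Q - B * Q' ≈ J - Q' + fromℕ 1
        i≈ = begin
          A * Q - B * Q' ≈⟨ +-cong (*-congʳ (lincomb p' q')) (-‿cong (*-congʳ (lincomb p q))) ⟩
          ((J - Q' + fromℕ 1) * P' + (- K - P) * Q') * Q - ((J - Q' + fromℕ 1) * P + (- K - P) * Q) * Q'
            ≈⟨ modulo {k = J - Q' + fromℕ 1} det
                 (solve 6 (λ J K P Q P' Q' → ((J :- Q' :+ con (+ 1)) :* P' :+ (:- K :- P) :* Q') :* Q :- ((J :- Q' :+ con (+ 1)) :* P :+ (:- K :- P) :* Q) :* Q'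
                   := (J :- Q' :+ con (+ 1)) :+ (J :- Q' :+ con (+ 1)) :* (P' :* Q :- P :* Q' :- con (+ 1)))
                   refl J K P Q P' Q') ⟩
          J - Q' + fromℕ 1 ∎
        0<x-L : 0# < A * δ + B * δ'
        0<x-L = <-respʳ-≈ x-L≈ (<⇒0< L<x)
        x-L< : 0# < δ + δ' - (A * δ + B * δ')
        x-L< = <-respʳ-≈ (begin
          R - x              ≈⟨ solve 3 (λ L R x → R :- x := (R :- L) :- (x :- L)) refl L R x ⟩
          (R - L) - (x - L)  ≈⟨ +-cong R-L≈ (-‿cong x-L≈) ⟩
          δ + δ' - (A * δ + B * δ') ∎) (<⇒0< x<R)
        cases : A ≤ 0# ⊎ fromℕ 1 ≤ A → B ≤ 0# ⊎ fromℕ 1 ≤ B → suc m ℕ.< q ℕ.+ q' ⊎ δ ≈ 0# → ⊥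
        cases (inj₁ A≤0) (inj₁ B≤0) _ = absurd (0<x-L +⁺⁰ ≤⇒0≤ A≤0 *⁰⁰ 0≤δ +⁺⁰ ≤⇒0≤ B≤0 *⁰⁰ 0≤δ')
          (solve 4 (λ A B δ δ' → (A :* δ :+ B :* δ') :+ (con (+ 0) :- A) :* δ :+ (con (+ 0) :- B) :* δ' := con (+ 0)) refl A B δ δ')
        cases (inj₂ 1≤A) (inj₂ 1≤B) _ = absurd (x-L< +⁺⁰ ≤⇒0≤ 1≤A *⁰⁰ 0≤δ +⁺⁰ ≤⇒0≤ 1≤B *⁰⁰ 0≤δ')
          (solve 4 (λ A B δ δ' → (δ :+ δ' :- (A :* δ :+ B :* δ')) :+ (A :- con (+ 1)) :* δ :+ (B :- con (+ 1)) :* δ' := con (+ 0)) refl A B δ δ')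
        cases (inj₂ 1≤A) (inj₁ B≤0) (inj₁ m<) = absurd
          (0<fromℕ 1 +⁺⁰ ≤⇒0≤ 1≤A *⁰⁰ 0≤fromℕ q +⁺⁰ ≤⇒0≤ B≤0 *⁰⁰ 0≤fromℕ q' +⁺⁰ ≤⇒0≤ j<)
          (modulo {k = fromℕ 1} i≈ (solve 5 (λ A B J Q Q' → con (+ 1) :+ (A :- con (+ 1)) :* Q :+ (con (+ 0) :- B) :* Q' :+ (Q :+ Q' :- (con (+ 2) :+ J))
             := con (+ 0) :+ con (+ 1) :* ((A :* Q :- B :* Q') :- (J :- Q' :+ con (+ 1)))) refl A B J Q Q'))
          where
          j< : fromℕ 2 + J ≤ Q + Q'
          j< = ≤-respˡ-≈ (fromℕ-+ 2 j) (≤-respʳ-≈ (fromℕ-+ q q') (fromℕ-mono (ℕₚ.≤-trans (s≤s (s≤s j≤m)) m<)))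
        cases (inj₁ A≤0) (inj₂ 1≤B) (inj₁ m<) = absurd
          (0<fromℕ 1 +⁺⁰ ≤⇒0≤ A≤0 *⁰⁰ 0≤fromℕ q +⁺⁰ ≤⇒0≤ 1≤B *⁰⁰ 0≤fromℕ q' +⁺⁰ 0≤fromℕ j)
          (modulo {k = - fromℕ 1} i≈ (solve 5 (λ A B J Q Q' → con (+ 1) :+ (con (+ 0) :- A) :* Q :+ (B :- con (+ 1)) :* Q' :+ J
             := con (+ 0) :+ (:- con (+ 1)) :* ((A :* Q :- B :* Q') :- (J :- Q' :+ con (+ 1)))) refl A B J Q Q'))
        -- If δ = 0, the offset is B δ' and lies strictly between 0 and δ', which no integer B
        -- allows, whatever `m` is.
        cases (inj₂ _) (inj₁ B≤0) (inj₂ δ≈0) = absurd (0<x-L +⁺⁰ ≤⇒0≤ B≤0 *⁰⁰ 0≤δ')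
          (modulo {k = A} δ≈0 (solve 4 (λ A B δ δ' → (A :* δ :+ B :* δ') :+ (con (+ 0) :- B) :* δ' := con (+ 0) :+ A :* (δ :- con (+ 0))) refl A B δ δ'))
        cases (inj₁ _) (inj₂ 1≤B) (inj₂ δ≈0) = absurd (x-L< +⁺⁰ ≤⇒0≤ 1≤B *⁰⁰ 0≤δ')
          (modulo {k = fromℕ 1 - A} δ≈0 (solve 4 (λ A B δ δ' → (δ :+ δ' :- (A :* δ :+ B :* δ')) :+ (B :- con (+ 1)) :* δ' := con (+ 0) :+ (con (+ 1) :- A) :* (δ :- con (+ 0))) refl A B δ δ'))

    private
      is-d : 0# ≤ δ → 0# ≤ δ' → suc m ℕ.< q ℕ.+ q' ⊎ δ ≈ 0# → (∀ {I} → Avoids θ m I → ∣ I ∣ ≤ δ + δ') → Is-d θ m (δ + δ')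
      is-d 0≤δ 0≤δ' small bound = (λ l (I , avoids , l≈) → ≤-respˡ-≈ (sym l≈) (bound {I} avoids))
        , (λ u u-bound → u-bound (δ + δ') (gap 0≤δ 0≤δ' , gap-avoids 0≤δ 0≤δ' small , sym (∣gap∣≈ 0≤δ 0≤δ')))

    -- The number of points is m + 1 = q + q' - 1, the largest for which the gap is still δ + δ';
    -- hence this `m` gives the greatest scaled value belonging to the pair.
    Is-d-pair : 0# < δ → 0# < δ' → suc (suc m) ≡ q ℕ.+ q' → Is-d θ m (δ + δ')
    Is-d-pair {m} 0<δ 0<δ' eq = is-d (<⇒≤ 0<δ) (<⇒≤ 0<δ') (inj₁ (ℕₚ.≤-reflexive eq))
      λ {I} → gap≤ {I = I} 0<δ 0<δ' (ℕₚ.≤-pred (≡.subst (q ℕ.<_) (≡.sym eq) (ℕₚ.m<m+n q 1≤q')))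
        (ℕₚ.≤-pred (≡.subst (q' ℕ.<_) (≡.sym eq) (ℕₚ.m<n+m q' 1≤q)))

    Is-d-rational : δ ≈ 0# → 0# < δ' → q' ℕ.≤ q → q ℕ.≤ suc m → Is-d θ m (δ + δ')
    Is-d-rational δ≈0 0<δ' q'≤q q≤N = is-d (≤-reflexive (sym δ≈0)) (<⇒≤ 0<δ') (inj₂ δ≈0)
      λ {I} → gap≤-rational {I = I} δ≈0 0<δ' q'≤q q≤N

-- Nodes of the Stern-Brocot path and their values.

module Nodes {c ℓ₁ ℓ₂ ℓ₃} (ℝ : RealNumbers c ℓ₁ ℓ₂ ℓ₃) where
  open OrderedField ℝ
  open LargestGap ℝ

  record Node (θ : Carrier) (p q p' q' : ℕ) (δ δ' : Carrier) : Set (ℓ₁ ⊔ ℓ₃) where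
    constructor node
    field
      pair : FareyPair θ p q p' q' δ δ'
      0<δ  : 0# < δ
      0<δ' : 0# < δ'

  module _ {θ : Carrier} {p q p' q' : ℕ} {δ δ' : Carrier} where

    leftPair : FareyPair θ p q p' q' δ δ' → FareyPair θ p q (p' ℕ.+ p) (q' ℕ.+ q) δ (δ' - δ)
    leftPair pair = record
      { 1≤q  = 1≤q
      ; 1≤q' = ℕₚ.≤-trans 1≤q' (ℕₚ.m≤m+n q' q)
      ; det  = trans (+-cong (*-congʳ (fromℕ-+ p' p)) (-‿cong (*-congˡ (fromℕ-+ q' q))))
          (trans (solve 4 (λ p q p' q' → (p' :+ p) :* q :- p :* (q' :+ q) := p' :* q :- p :* q') refl (fromℕ p) (fromℕ q) (fromℕ p') (fromℕ q')) det)
      ; δ≈   = δ≈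
      ; δ'≈  = trans (+-cong δ'≈ (-‿cong δ≈)) (trans
          (solve 5 (λ p q p' q' θ → p' :- q' :* θ :- (q :* θ :- p) := (p' :+ p) :- (q' :+ q) :* θ) refl (fromℕ p) (fromℕ q) (fromℕ p') (fromℕ q') θ)
          (sym (+-cong (fromℕ-+ p' p) (-‿cong (*-congʳ (fromℕ-+ q' q))))))
      }
      where open FareyPair pair

    rightPair : FareyPair θ p q p' q' δ δ' → FareyPair θ (p ℕ.+ p') (q ℕ.+ q') p' q' (δ - δ') δ'
    rightPair pair = record
      { 1≤q  = ℕₚ.≤-trans 1≤q (ℕₚ.m≤m+n q q')
      ; 1≤q' = 1≤q'
      ; det  = trans (+-cong (*-congˡ (fromℕ-+ q q')) (-‿cong (*-congʳ (fromℕ-+ p p'))))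
          (trans (solve 4 (λ p q p' q' → p' :* (q :+ q') :- (p :+ p') :* q' := p' :* q :- p :* q') refl (fromℕ p) (fromℕ q) (fromℕ p') (fromℕ q')) det)
      ; δ≈   = trans (+-cong δ≈ (-‿cong δ'≈)) (trans
          (solve 5 (λ p q p' q' θ → q :* θ :- p :- (p' :- q' :* θ) := (q :+ q') :* θ :- (p :+ p')) refl (fromℕ p) (fromℕ q) (fromℕ p') (fromℕ q') θ)
          (sym (+-cong (*-congʳ (fromℕ-+ q q')) (-‿cong (fromℕ-+ p p')))))
      ; δ'≈  = δ'≈
      }
      where open FareyPair pair

    leftChild : Node θ p q p' q' δ δ' → δ < δ' → Node θ p q (p' ℕ.+ p) (q' ℕ.+ q) δ (δ' - δ)
    leftChild (node pair 0<δ _) δ<δ' = node (leftPair pair) 0<δ (<⇒0< δ<δ')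

    rightChild : Node θ p q p' q' δ δ' → δ' < δ → Node θ (p ℕ.+ p') (q ℕ.+ q') p' q' (δ - δ') δ'
    rightChild (node pair _ 0<δ') δ'<δ = node (rightPair pair) (<⇒0< δ'<δ) 0<δ'

  -- A node without its orientation: (q , δ) may belong to the left or to the right neighbour of θ.
  data Node± (θ : Carrier) (q q' : ℕ) (δ δ' : Carrier) : Set (ℓ₁ ⊔ ℓ₃) where
    node⁺ : ∀ {p p'} → Node θ p q p' q' δ δ' → Node± θ q q' δ δ'
    node⁻ : ∀ {p p'} → Node θ p' q' p q δ' δ → Node± θ q q' δ δ'

  module _ {θ : Carrier} {q q' : ℕ} {δ δ' : Carrier} where

    swap : Node± θ q q' δ δ' → Node± θ q' q δ' δ
    swap (node⁺ N) = node⁻ N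
    swap (node⁻ N) = node⁺ N

    child : Node± θ q q' δ δ' → δ' < δ → Node± θ (q ℕ.+ q') q' (δ - δ') δ'
    child (node⁺ N) δ'<δ = node⁺ (rightChild N δ'<δ)
    child (node⁻ N) δ'<δ = node⁻ (leftChild N δ'<δ)

    1≤q,q' : Node± θ q q' δ δ' → 1 ℕ.≤ q × 1 ℕ.≤ q'
    1≤q,q' (node⁺ (node pair _ _)) = FareyPair.1≤q pair , FareyPair.1≤q' pair
    1≤q,q' (node⁻ (node pair _ _)) = FareyPair.1≤q' pair , FareyPair.1≤q pair

    0<δ,δ' : Node± θ q q' δ δ' → 0# < δ × 0# < δ'
    0<δ,δ' (node⁺ (node _ 0<δ 0<δ')) = 0<δ , 0<δ'
    0<δ,δ' (node⁻ (node _ 0<δ' 0<δ)) = 0<δ , 0<δ'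

    unit± : Node± θ q q' δ δ' → fromℕ q * δ' + fromℕ q' * δ ≈ fromℕ 1
    unit± (node⁺ (node pair _ _)) = FareyPair.unit pair
    unit± (node⁻ (node pair _ _)) = trans (+-comm _ _) (FareyPair.unit pair)

    gap≤± : ∀ {m I} → Node± θ q q' δ δ' → q ℕ.≤ suc m → q' ℕ.≤ suc m → Avoids θ m I → ∣ I ∣ ≤ δ + δ'
    gap≤± {I = I} (node⁺ (node pair 0<δ 0<δ')) q≤ q'≤ avoids = gap≤ pair {I = I} 0<δ 0<δ' q≤ q'≤ avoids
    gap≤± {I = I} (node⁻ (node pair 0<δ' 0<δ)) q≤ q'≤ avoids = ≤-respʳ-≈ (+-comm δ' δ) (gap≤ pair {I = I} 0<δ' 0<δ q'≤ q≤ avoids)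

  Is-d-≈ : ∀ {θ m d e} → d ≈ e → Is-d θ m d → Is-d θ m e
  Is-d-≈ d≈e (bound , least) = (λ l l∈ → ≤-respʳ-≈ d≈e (bound l l∈)) , (λ u u-bound → ≤-respˡ-≈ d≈e (least u u-bound))

  Is-d± : ∀ {θ q q' δ δ' m} → Node± θ q q' δ δ' → suc (suc m) ≡ q ℕ.+ q' → Is-d θ m (δ + δ')
  Is-d± (node⁺ (node pair 0<δ 0<δ')) eq = Is-d-pair pair 0<δ 0<δ' eq
  Is-d± {q = q} {q'} {δ} {δ'} (node⁻ (node pair 0<δ' 0<δ)) eq =
    Is-d-≈ (+-comm δ' δ) (Is-d-pair pair 0<δ' 0<δ (≡.trans eq (ℕₚ.+-comm q q')))

  UpperBound : Carrier → Carrier → Set (c ⊔ ℓ₁ ⊔ ℓ₃)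
  UpperBound θ u = ∀ {m d} → 1 ℕ.≤ m → Is-d θ m d → fromℕ (suc m) * d ≤ u

  -- The value at a node is the scaled gap for m = q + q' - 2. The condition on q + q' leaves out
  -- the root, which would belong to m = 0.
  node-value≤ : ∀ {θ q q' δ δ' u} → UpperBound θ u → Node± θ q q' δ δ' → 3 ℕ.≤ q ℕ.+ q' →
    (fromℕ q + fromℕ q' - fromℕ 1) * (δ + δ') ≤ u
  node-value≤ {q = q} {q'} {δ} {δ'} {u} bound N 3≤n = go (q ℕ.+ q') ≡.refl 3≤n
    where
    go : ∀ n → n ≡ q ℕ.+ q' → 3 ℕ.≤ n → (fromℕ q + fromℕ q' - fromℕ 1) * (δ + δ') ≤ u
    go (suc (suc m)) eq (s≤s (s≤s 1≤m)) = ≤-respˡ-≈ (sym (*-congʳ (begin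
      fromℕ q + fromℕ q' - fromℕ 1              ≈⟨ +-congʳ (fromℕ-+ q q') ⟨
      fromℕ (q ℕ.+ q') - fromℕ 1                ≡⟨ ≡.cong (λ n → fromℕ n - fromℕ 1) eq ⟨
      fromℕ (suc (suc m)) - fromℕ 1             ≈⟨ +-cong (fromℕ-+ 1 (suc m)) refl ⟩
      (fromℕ 1 + fromℕ (suc m)) - fromℕ 1       ≈⟨ solve 1 (λ x → con (+ 1) :+ x :- con (+ 1) := x) refl (fromℕ (suc m)) ⟩
      fromℕ (suc m)                             ∎))) (bound 1≤m (Is-d± N eq))
      where open import Relation.Binary.Reasoning.Setoid setoid

  -- Raising m + 1 to q + q' - 1 while the gap bound stays δ + δ' only increases the product. In
  -- terms of interval lengths the estimate presupposes no supremum.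
  interval-bound : ∀ {θ q q' δ δ' u m I} → Node± θ q q' δ δ' → (fromℕ q + fromℕ q' - fromℕ 1) * (δ + δ') ≤ u →
    q ℕ.≤ suc m → q' ℕ.≤ suc m → suc m ℕ.< q ℕ.+ q' → Avoids θ m I → fromℕ (suc m) * ∣ I ∣ ≤ u
  interval-bound {q = q} {q'} {δ} {δ'} {u} {m} {I} N value≤ q≤ q'≤ N<n avoids = 0≤⇒≤
    (solve 6 (λ M l q q' d u → M :* (d :- l) :+ (q :+ q' :- (con (+ 1) :+ M)) :* d :+ (u :- (q :+ q' :- con (+ 1)) :* d) := u :- M :* l)
      refl (fromℕ (suc m)) ∣ I ∣ (fromℕ q) (fromℕ q') (δ + δ') u)
    (0≤fromℕ (suc m) *⁰⁰ ≤⇒0≤ (gap≤± {I = I} N q≤ q'≤ avoids)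
      +⁰⁰ ≤⇒0≤ n≥ *⁰⁰ <⇒≤ (proj₁ (0<δ,δ' N) +⁺⁺ proj₂ (0<δ,δ' N))
      +⁰⁰ ≤⇒0≤ value≤)
    where
    n≥ : fromℕ 1 + fromℕ (suc m) ≤ fromℕ q + fromℕ q'
    n≥ = ≤-respˡ-≈ (fromℕ-+ 1 (suc m)) (≤-respʳ-≈ (fromℕ-+ q q') (fromℕ-mono N<n))

-- Golden tails of the path.

-- The sign tests rest on the Fibonacci bounds 8/5 < φ < 13/8. The relation for `v` is √5 v = √5 +
-- 2, with √5 expressed by φ.
record GoldenRatio {c ℓ₁ ℓ₂ ℓ₃} (ℝ : RealNumbers c ℓ₁ ℓ₂ ℓ₃) : Set (c ⊔ ℓ₁ ⊔ ℓ₃) where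
  open OrderedField ℝ
  field
    φ      : Carrier
    0<φ    : 0# < φ
    φ²≈    : φ * φ ≈ φ + fromℕ 1
    8<5φ   : fromℕ 8 < fromℕ 5 * φ
    8φ<13  : fromℕ 8 * φ < fromℕ 13
    √5     : Carrier
    √5≈    : √5 ≈ fromℕ 2 * φ - fromℕ 1
    v      : Carrier
    v≈     : (fromℕ 2 * φ - fromℕ 1) * v ≈ fromℕ 2 * φ + fromℕ 1

module GoldenTail {c ℓ₁ ℓ₂ ℓ₃} (ℝ : RealNumbers c ℓ₁ ℓ₂ ℓ₃) (G : GoldenRatio ℝ) where
  open OrderedField ℝ
  open GoldenRatio G
  open LargestGap ℝ
  open Nodes ℝ

  0<φ-1 : 0# < φ - fromℕ 1
  0<φ-1 = 0<-cancelˡ 0<φ (<-respʳ-≈ (sym (modulo {k = fromℕ 1} φ²≈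
    (solve 1 (λ φ → φ :* (φ :- con (+ 1)) := con (+ 1) :+ con (+ 1) :* (φ :* φ :- (φ :+ con (+ 1)))) refl φ))) (0<fromℕ 1))

  0<2φ-1 : 0# < fromℕ 2 * φ - fromℕ 1
  0<2φ-1 = <-respʳ-≈ (solve 1 (λ φ → (φ :- con (+ 1)) :+ φ := con (+ 2) :* φ :- con (+ 1)) refl φ) (0<φ-1 +⁺⁺ 0<φ)

  module _ {θ : Carrier} {q q' : ℕ} {δ δ' : Carrier} (N : Node± θ q q' δ δ') (golden : δ ≈ φ * δ') where
    private
      Q = fromℕ q
      Q' = fromℕ q'
      0<δ' = proj₂ (0<δ,δ' N)

    golden-order : δ' < δ
    golden-order = 0<⇒< (trans (solve 2 (λ φ δ' → (φ :- con (+ 1)) :* δ' := φ :* δ' :- δ') refl φ δ') (+-congʳ (sym golden))) (0<φ-1 *⁺⁺ 0<δ')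

    golden-child : Node± θ q' (q ℕ.+ q') δ' (δ - δ')
    golden-child = swap (child N golden-order)

    golden-child-ratio : δ' ≈ φ * (δ - δ')
    golden-child-ratio = sym (trans (*-congˡ (+-congʳ golden)) (modulo {k = δ'} φ²≈
      (solve 2 (λ φ δ' → φ :* (φ :* δ' :- δ') := δ' :+ δ' :* (φ :* φ :- (φ :+ con (+ 1)))) refl φ δ')))

    golden-unit : (Q + Q' * φ) * δ' ≈ fromℕ 1
    golden-unit = trans (trans (solve 4 (λ Q Q' φ δ' → (Q :+ Q' :* φ) :* δ' := Q :* δ' :+ Q' :* (φ :* δ')) refl Q Q' φ δ')
      (+-congˡ (*-congˡ (sym golden)))) (unit± N)

    -- √5 (v − f) = δ' (√5 φ² − (q φ − q')) for the value f = (q + q' − 1)(δ + δ') of a golden node, where √5 φ² = 3 φ + 1.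
    golden-deficit : (fromℕ 2 * φ - fromℕ 1) * (v - (Q + Q' - fromℕ 1) * (δ + δ')) ≈ δ' * (fromℕ 3 * φ + fromℕ 1 - (Q * φ - Q'))
    golden-deficit = begin
      (fromℕ 2 * φ - fromℕ 1) * (v - (Q + Q' - fromℕ 1) * (δ + δ'))
        ≈⟨ modulo {k = fromℕ 1} v≈ (solve 4 (λ φ v n d → (con (+ 2) :* φ :- con (+ 1)) :* (v :- n :* d)
             := ((con (+ 2) :* φ :+ con (+ 1)) :- (con (+ 2) :* φ :- con (+ 1)) :* (n :* d)) :+ con (+ 1) :* ((con (+ 2) :* φ :- con (+ 1)) :* v :- (con (+ 2) :* φ :+ con (+ 1)))) refl φ v _ _) ⟩
      (fromℕ 2 * φ + fromℕ 1) - (fromℕ 2 * φ - fromℕ 1) * ((Q + Q' - fromℕ 1) * (δ + δ'))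
        ≈⟨ +-congˡ (-‿cong (*-congˡ (*-congˡ (+-congʳ golden)))) ⟩
      (fromℕ 2 * φ + fromℕ 1) - (fromℕ 2 * φ - fromℕ 1) * ((Q + Q' - fromℕ 1) * (φ * δ' + δ'))
        ≈⟨ modulo {k = - (fromℕ 2 * φ + fromℕ 1)} golden-unit (solve 4 (λ Q Q' φ δ' →
             (con (+ 2) :* φ :+ con (+ 1)) :- (con (+ 2) :* φ :- con (+ 1)) :* ((Q :+ Q' :- con (+ 1)) :* (φ :* δ' :+ δ'))
             := ((con (+ 2) :* φ :+ con (+ 1)) :* ((Q :+ Q' :* φ) :* δ') :- (con (+ 2) :* φ :- con (+ 1)) :* ((Q :+ Q' :- con (+ 1)) :* (φ :* δ' :+ δ')))
               :+ (:- (con (+ 2) :* φ :+ con (+ 1))) :* ((Q :+ Q' :* φ) :* δ' :- con (+ 1))) refl Q Q' φ δ') ⟩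
      (fromℕ 2 * φ + fromℕ 1) * ((Q + Q' * φ) * δ') - (fromℕ 2 * φ - fromℕ 1) * ((Q + Q' - fromℕ 1) * (φ * δ' + δ'))
        ≈⟨ modulo {k = δ' * (fromℕ 2 - fromℕ 2 * Q)} φ²≈ (solve 4 (λ Q Q' φ δ' →
             (con (+ 2) :* φ :+ con (+ 1)) :* ((Q :+ Q' :* φ) :* δ') :- (con (+ 2) :* φ :- con (+ 1)) :* ((Q :+ Q' :- con (+ 1)) :* (φ :* δ' :+ δ'))
             := δ' :* (con (+ 3) :* φ :+ con (+ 1) :- (Q :* φ :- Q')) :+ (δ' :* (con (+ 2) :- con (+ 2) :* Q)) :* (φ :* φ :- (φ :+ con (+ 1)))) refl Q Q' φ δ') ⟩
      δ' * (fromℕ 3 * φ + fromℕ 1 - (Q * φ - Q')) ∎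
      where open import Relation.Binary.Reasoning.Setoid setoid

    golden-value≤ : Q * φ - Q' ≤ fromℕ 3 * φ + fromℕ 1 → (Q + Q' - fromℕ 1) * (δ + δ') ≤ v
    golden-value≤ g≤ = 0≤⇒≤ refl (0≤-cancelˡ 0<2φ-1 (≤-respʳ-≈ (sym golden-deficit) (<⇒≤ 0<δ' *⁰⁰ ≤⇒0≤ g≤)))

  -- One step down a golden tail multiplies q φ − q' by 1 − φ = − 1 / φ.
  step-g : ∀ q q' → fromℕ q' * φ - fromℕ (q ℕ.+ q') ≈ (fromℕ 1 - φ) * (fromℕ q * φ - fromℕ q')
  step-g q q' = trans (+-congˡ (-‿cong (fromℕ-+ q q'))) (sym (modulo {k = - fromℕ q} φ²≈
    (solve 3 (λ φ q q' → (con (+ 1) :- φ) :* (q :* φ :- q') := (q' :* φ :- (q :+ q')) :+ (:- q) :* (φ :* φ :- (φ :+ con (+ 1)))) refl φ (fromℕ q) (fromℕ q'))))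

  module _ {q q' : ℕ} where
    private g = fromℕ q * φ - fromℕ q'

    -- Here 3 φ + 1 = √5 φ² and 4 φ + 3 = √5 φ³. Multiplication by -1 / φ maps the interval from -√5
    -- φ³ to √5 φ² into itself, the lower end going exactly to the upper one. So both bounds are
    -- inherited along the tail.
    child-g≤ : - g ≤ fromℕ 4 * φ + fromℕ 3 → fromℕ q' * φ - fromℕ (q ℕ.+ q') ≤ fromℕ 3 * φ + fromℕ 1
    child-g≤ -g≤ = ≤-respˡ-≈ (sym (step-g q q')) (0≤⇒≤ (modulo {k = fromℕ 4} φ²≈
      (solve 2 (λ φ g → (φ :- con (+ 1)) :* ((con (+ 4) :* φ :+ con (+ 3)) :- (:- g))
         := (con (+ 3) :* φ :+ con (+ 1) :- (con (+ 1) :- φ) :* g) :+ con (+ 4) :* (φ :* φ :- (φ :+ con (+ 1)))) refl φ g))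
      (<⇒≤ 0<φ-1 *⁰⁰ ≤⇒0≤ -g≤))

    child--g≤ : g ≤ fromℕ 3 * φ + fromℕ 1 → - (fromℕ q' * φ - fromℕ (q ℕ.+ q')) ≤ fromℕ 4 * φ + fromℕ 3
    child--g≤ g≤ = ≤-respˡ-≈ (sym (-‿cong (step-g q q'))) (0≤⇒≤ (modulo {k = fromℕ 3} φ²≈
      (solve 2 (λ φ g → (φ :- con (+ 1)) :* ((con (+ 3) :* φ :+ con (+ 1)) :- g) :+ (con (+ 3) :* φ :+ con (+ 1))
         := (con (+ 4) :* φ :+ con (+ 3) :- (:- ((con (+ 1) :- φ) :* g))) :+ con (+ 3) :* (φ :* φ :- (φ :+ con (+ 1)))) refl φ g))
      (<⇒≤ 0<φ-1 *⁰⁰ ≤⇒0≤ g≤ +⁰⁰ (0≤fromℕ 3 *⁰⁰ <⇒≤ 0<φ +⁰⁰ 0≤fromℕ 1)))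

  -- The descent stops at the first node with q + q' > m + 1, where `interval-bound` applies. Each
  -- step raises q + q' by q' ≥ 1, which pays for one unit of `fuel`.
  golden-bound : ∀ fuel {θ q q' δ δ' m I} → Node± θ q q' δ δ' → δ ≈ φ * δ' →
    fromℕ q * φ - fromℕ q' ≤ fromℕ 3 * φ + fromℕ 1 → - (fromℕ q * φ - fromℕ q') ≤ fromℕ 4 * φ + fromℕ 3 →
    q ℕ.≤ suc m → q' ℕ.≤ suc m → suc m ℕ.< q ℕ.+ q' ℕ.+ fuel → Avoids θ m I → fromℕ (suc m) * ∣ I ∣ ≤ v
  golden-bound zero {q = q} {q'} {m = m} {I = I} N golden g≤ -g≤ q≤ q'≤ N< =
    interval-bound {I = I} N (golden-value≤ N golden g≤) q≤ q'≤ (≡.subst (suc m ℕ.<_) (ℕₚ.+-identityʳ (q ℕ.+ q')) N<)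
  golden-bound (suc fuel) {q = q} {q'} {m = m} {I = I} N golden g≤ -g≤ q≤ q'≤ N< with q ℕ.+ q' ℕₚ.≤? suc m
  ... | no n≰  = interval-bound {I = I} N (golden-value≤ N golden g≤) q≤ q'≤ (ℕₚ.≰⇒> n≰)
  ... | yes n≤ = golden-bound fuel {I = I} (golden-child N golden) (golden-child-ratio N golden)
    (child-g≤ {q} {q'} -g≤) (child--g≤ {q} {q'} g≤) q'≤ n≤ (ℕₚ.<-≤-trans N< (begin
      q ℕ.+ q' ℕ.+ suc fuel          ≡⟨ ℕₚ.+-suc (q ℕ.+ q') fuel ⟩
      1 ℕ.+ (q ℕ.+ q') ℕ.+ fuel      ≤⟨ ℕₚ.+-monoˡ-≤ fuel (ℕₚ.+-monoˡ-≤ (q ℕ.+ q') (proj₂ (1≤q,q' N))) ⟩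
      q' ℕ.+ (q ℕ.+ q') ℕ.+ fuel     ∎))
    where open ℕₚ.≤-Reasoning

  module _ {θ u : Carrier} (bound : UpperBound θ u) (u<v : u < v) where
    private
      w = (fromℕ 2 * φ - fromℕ 1) * φ * (v - u)
      0<w : 0# < w
      0<w = 0<2φ-1 *⁺⁺ 0<φ *⁺⁺ <⇒0< u<v

    -- Write f for the value and g = q φ - q'. Then √5 (v - u) ≤ √5 (v - f) = δ' (3 φ + 1 - g) ≤ δ'
    -- (7 φ + 4), and q' φ δ' ≤ 1, so q' w ≤ 7 φ + 4. Each step down raises q' by q ≥ 1; looking `t`
    -- steps ahead adds `t` to the factor.
    golden-limit : ∀ t {q q' δ δ'} → Node± θ q q' δ δ' → δ ≈ φ * δ' →
      fromℕ q * φ - fromℕ q' ≤ fromℕ 3 * φ + fromℕ 1 → - (fromℕ q * φ - fromℕ q') ≤ fromℕ 4 * φ + fromℕ 3 →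
      3 ℕ.≤ q ℕ.+ q' → (fromℕ t + fromℕ q') * w ≤ fromℕ 7 * φ + fromℕ 4
    golden-limit zero {q} {q'} {δ} {δ'} N golden g≤ -g≤ 3≤n = 0≤⇒≤
      (modulo {k = fromℕ 7 * φ + fromℕ 4} (golden-unit N golden) (modulo {k = fromℕ q' * φ} (golden-deficit N golden)
        (solve 7 (λ Q Q' φ δ' v u f →
           (con (+ 7) :* φ :+ con (+ 4)) :* (Q :* δ') :+ Q' :* φ :* (δ' :* (con (+ 4) :* φ :+ con (+ 3) :- (:- (Q :* φ :- Q')))) :+ Q' :* φ :* ((con (+ 2) :* φ :- con (+ 1)) :* (u :- f))
           := con (+ 7) :* φ :+ con (+ 4) :- (con (+ 0) :+ Q') :* ((con (+ 2) :* φ :- con (+ 1)) :* φ :* (v :- u))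
              :+ (con (+ 7) :* φ :+ con (+ 4)) :* ((Q :+ Q' :* φ) :* δ' :- con (+ 1))
              :+ Q' :* φ :* ((con (+ 2) :* φ :- con (+ 1)) :* (v :- f) :- δ' :* (con (+ 3) :* φ :+ con (+ 1) :- (Q :* φ :- Q'))))
           refl (fromℕ q) (fromℕ q') φ δ' v u ((fromℕ q + fromℕ q' - fromℕ 1) * (δ + δ')))))
      (<⇒≤ (0<fromℕ 7 *⁺⁺ 0<φ +⁺⁺ 0<fromℕ 4) *⁰⁰ (0≤fromℕ q *⁰⁰ 0≤δ')
        +⁰⁰ 0≤fromℕ q' *⁰⁰ <⇒≤ 0<φ *⁰⁰ (0≤δ' *⁰⁰ ≤⇒0≤ -g≤)
        +⁰⁰ 0≤fromℕ q' *⁰⁰ <⇒≤ 0<φ *⁰⁰ (<⇒≤ 0<2φ-1 *⁰⁰ ≤⇒0≤ (node-value≤ bound N 3≤n)))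
      where
      0≤δ' : 0# ≤ δ'
      0≤δ' = <⇒≤ (proj₂ (0<δ,δ' N))
    golden-limit (suc t) {q} {q'} N golden g≤ -g≤ 3≤n = 0≤⇒≤
      (trans (solve 5 (λ K t w Q Q' → (K :- (t :+ (Q :+ Q')) :* w) :+ (Q :- con (+ 1)) :* w := K :- ((con (+ 1) :+ t) :+ Q') :* w) refl
               (fromℕ 7 * φ + fromℕ 4) (fromℕ t) w (fromℕ q) (fromℕ q'))
             (+-congˡ (-‿cong (*-congʳ (+-congʳ (sym (fromℕ-+ 1 t)))))))
      (≤⇒0≤ (≤-respˡ-≈ (*-congʳ (+-congˡ (fromℕ-+ q q')))
          (golden-limit t (golden-child N golden) (golden-child-ratio N golden) (child-g≤ {q} {q'} -g≤) (child--g≤ {q} {q'} g≤)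
            (ℕₚ.≤-trans 3≤n (ℕₚ.m≤n+m (q ℕ.+ q') q'))))
        +⁰⁰ ≤⇒0≤ (fromℕ-mono (proj₁ (1≤q,q' N))) *⁰⁰ <⇒≤ 0<w)

    golden-sup : ∀ {q q' δ δ'} → Node± θ q q' δ δ' → δ ≈ φ * δ' →
      fromℕ q * φ - fromℕ q' ≤ fromℕ 3 * φ + fromℕ 1 → - (fromℕ q * φ - fromℕ q') ≤ fromℕ 4 * φ + fromℕ 3 → ⊥
    golden-sup {q} {q'} N golden g≤ -g≤ = absurd (<⇒0< K<tw +⁺⁰ ≤⇒0≤ limit +⁺⁰ 0≤fromℕ (q ℕ.+ q') *⁰⁰ <⇒≤ 0<w)
      (solve 4 (λ K t w Q → (t :* w :- K) :+ (K :- (t :+ Q) :* w) :+ Q :* w := con (+ 0)) refl _ (fromℕ t) w (fromℕ (q ℕ.+ q')))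
      where
      t = proj₁ (archimedean* 0<w (fromℕ 7 * φ + fromℕ 4))
      K<tw = proj₂ (archimedean* 0<w (fromℕ 7 * φ + fromℕ 4))
      -- The limit is applied to the child, because the node itself may be the root, which has no
      -- value.
      3≤ : 3 ℕ.≤ q' ℕ.+ (q ℕ.+ q')
      3≤ = ℕₚ.+-mono-≤ (proj₂ (1≤q,q' N)) (ℕₚ.+-mono-≤ (proj₁ (1≤q,q' N)) (proj₂ (1≤q,q' N)))
      limit = golden-limit t (golden-child N golden) (golden-child-ratio N golden) (child-g≤ {q} {q'} -g≤) (child--g≤ {q} {q'} g≤) 3≤

  module _ {θ : Carrier} (bound : UpperBound θ v) (v<19/10 : fromℕ 10 * v < fromℕ 19) where

    -- A repeated direction gives the value at least 2 (1 − 1 / (q + q')) ≥ 19/10 > v.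
    alternates : ∀ {q q' δ δ'} → Node± θ q q' δ δ' → q ℕ.≤ q' → 20 ℕ.≤ q ℕ.+ q' → δ ≤ δ' → ⊥
    alternates {q} {q'} {δ} {δ'} N q≤q' 20≤n δ≤δ' = absurd
      (<⇒0< v<19/10
        +⁺⁰ 0≤fromℕ 10 *⁰⁰ ≤⇒0≤ (node-value≤ bound N (ℕₚ.≤-trans (ℕₚ.m≤m+n 3 17) 20≤n))
        +⁺⁰ (0≤fromℕ 9 *⁰⁰ ≤⇒0≤ (fromℕ-mono q≤q') +⁰⁰ ≤⇒0≤ 10≤q') *⁰⁰ ≤⇒0≤ δ≤δ'
        +⁺⁰ <⇒≤ (proj₁ (0<δ,δ' N)) *⁰⁰ ≤⇒0≤ 20≤Q+Q')
      (modulo {k = - fromℕ 19} (unit± N) (solve 5 (λ q q' δ δ' v →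
        (con (+ 19) :- con (+ 10) :* v) :+ con (+ 10) :* (v :- (q :+ q' :- con (+ 1)) :* (δ :+ δ'))
          :+ (con (+ 9) :* (q' :- q) :+ (q' :- con (+ 10))) :* (δ' :- δ) :+ δ :* (q :+ q' :- con (+ 20))
        := con (+ 0) :+ (:- con (+ 19)) :* (q :* δ' :+ q' :* δ :- con (+ 1))) refl (fromℕ q) (fromℕ q') δ δ' v))
      where
      10≤q' : fromℕ 10 ≤ fromℕ q'
      10≤q' = fromℕ-mono {10} {q'} (ℕₚ.*-cancelˡ-≤ 2 (ℕₚ.≤-trans 20≤n (ℕₚ.≤-trans (ℕₚ.+-monoˡ-≤ q' q≤q') (ℕₚ.≤-reflexive (≡.cong (q' ℕ.+_) (≡.sym (ℕₚ.+-identityʳ q')))))))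
      20≤Q+Q' : fromℕ 20 ≤ fromℕ q + fromℕ q'
      20≤Q+Q' = ≤-respʳ-≈ (fromℕ-+ q q') (fromℕ-mono 20≤n)

    private
      error² : Carrier → Carrier → Carrier
      error² δ δ' = (δ - φ * δ') * (δ - φ * δ')

      -- The unit relation gives δ, δ' ≤ 1. The error is squared because it changes sign at each
      -- step.
      error²≤ : ∀ {q q' δ δ'} → Node± θ q q' δ δ' → error² δ δ' ≤ (fromℕ 1 + φ) * (fromℕ 1 + φ)
      error²≤ {q} {q'} {δ} {δ'} N = 0≤⇒≤
        (solve 3 (λ φ δ δ' → ((con (+ 1) :- δ) :+ φ :+ φ :* δ') :* ((con (+ 1) :+ δ) :+ φ :* (con (+ 1) :- δ')) := (con (+ 1) :+ φ) :* (con (+ 1) :+ φ) :- (δ :- φ :* δ') :* (δ :- φ :* δ')) refl φ δ δ')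
        ((≤⇒0≤ δ≤1 +⁰⁰ 0≤φ +⁰⁰ 0≤φ *⁰⁰ 0≤δ') *⁰⁰ ((0≤fromℕ 1 +⁰⁰ 0≤δ) +⁰⁰ 0≤φ *⁰⁰ ≤⇒0≤ δ'≤1))
        where
        0≤φ = <⇒≤ 0<φ
        0≤δ = <⇒≤ (proj₁ (0<δ,δ' N))
        0≤δ' = <⇒≤ (proj₂ (0<δ,δ' N))
        δ≤1 : δ ≤ fromℕ 1
        δ≤1 = 0≤⇒≤ (modulo {k = fromℕ 1} (unit± N) (solve 4 (λ q q' δ δ' → (q' :- con (+ 1)) :* δ :+ q :* δ' := con (+ 1) :- δ :+ con (+ 1) :* (q :* δ' :+ q' :* δ :- con (+ 1))) refl (fromℕ q) (fromℕ q') δ δ'))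
          (≤⇒0≤ (fromℕ-mono (proj₂ (1≤q,q' N))) *⁰⁰ 0≤δ +⁰⁰ 0≤fromℕ q *⁰⁰ 0≤δ')
        δ'≤1 : δ' ≤ fromℕ 1
        δ'≤1 = 0≤⇒≤ (modulo {k = fromℕ 1} (unit± N) (solve 4 (λ q q' δ δ' → (q :- con (+ 1)) :* δ' :+ q' :* δ := con (+ 1) :- δ' :+ con (+ 1) :* (q :* δ' :+ q' :* δ :- con (+ 1))) refl (fromℕ q) (fromℕ q') δ δ'))
          (≤⇒0≤ (fromℕ-mono (proj₁ (1≤q,q' N))) *⁰⁰ 0≤δ' +⁰⁰ 0≤fromℕ q' *⁰⁰ 0≤δ)

      -- Each step multiplies δ − φ δ' by − φ, and the result stays bounded.
      error²-decay : ∀ t {q q' δ δ'} → Node± θ q q' δ δ' → q ℕ.≤ q' → 20 ℕ.≤ q ℕ.+ q' →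
        fromℕ (suc t) * error² δ δ' ≤ (fromℕ 1 + φ) * (fromℕ 1 + φ)
      error²-decay zero {δ = δ} {δ'} N _ _ = ≤-respˡ-≈ (solve 1 (λ x → x := con (+ 1) :* x) refl (error² δ δ')) (error²≤ N)
      error²-decay (suc t) {q} {q'} {δ} {δ'} N q≤q' 20≤n larger = alternates N q≤q' 20≤n λ δ'<δ →
        0≤⇒≤
          (trans (solve 4 (λ b t φ x → (b :- t :* ((φ :+ con (+ 1)) :* x)) :+ t :* ((φ :- con (+ 1)) :* x) :+ (t :- con (+ 1)) :* x := b :- (con (+ 1) :+ t) :* x) refl
                   ((fromℕ 1 + φ) * (fromℕ 1 + φ)) (fromℕ (suc t)) φ (error² δ δ'))
                 (+-congˡ (-‿cong (*-congʳ (sym (fromℕ-+ 1 (suc t)))))))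
          (≤⇒0≤ (≤-respˡ-≈ (*-congˡ error²-step) (error²-decay t (swap (child N δ'<δ)) (ℕₚ.m≤n+m q' q) (ℕₚ.≤-trans 20≤n (ℕₚ.m≤n+m (q ℕ.+ q') q'))))
            +⁰⁰ 0≤fromℕ (suc t) *⁰⁰ (<⇒≤ 0<φ-1 *⁰⁰ 0≤x)
            +⁰⁰ ≤⇒0≤ (fromℕ-mono {1} {suc t} (s≤s z≤n)) *⁰⁰ 0≤x)
          larger
        where
        step≈ : δ' - φ * (δ - δ') ≈ - (φ * (δ - φ * δ'))
        step≈ = modulo {k = - δ'} φ²≈ (solve 3 (λ φ δ δ' → δ' :- φ :* (δ :- δ') := :- (φ :* (δ :- φ :* δ')) :+ (:- δ') :* (φ :* φ :- (φ :+ con (+ 1)))) refl φ δ δ')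
        error²-step : error² δ' (δ - δ') ≈ (φ + fromℕ 1) * error² δ δ'
        error²-step = trans (*-cong step≈ step≈) (trans
          (solve 2 (λ φ e → (:- (φ :* e)) :* (:- (φ :* e)) := (φ :* φ) :* (e :* e)) refl φ (δ - φ * δ'))
          (*-congʳ φ²≈))
        0≤x : 0# ≤ error² δ δ'
        0≤x = 0≤square (δ - φ * δ')

    -- A square whose multiples by all natural numbers stay below one bound is zero by the
    -- Archimedean property. The geometric growth of the error is needed only in this linear form.
    eventually-golden : ∀ {q q' δ δ'} → Node± θ q q' δ δ' → q ℕ.≤ q' → 20 ℕ.≤ q ℕ.+ q' → δ ≈ φ * δ'
    eventually-golden {q} {q'} {δ} {δ'} N q≤q' 20≤n = trans (solve 2 (λ δ y → δ := (δ :- y) :+ y) refl δ (φ * δ'))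
      (trans (+-congʳ (square≈0 λ 0<x → large 0<x)) (+-identityˡ _))
      where
      large : 0# < error² δ δ' → ⊥
      large 0<x = absurd (<⇒0< (proj₂ bound-t) +⁺⁰ ≤⇒0≤ (error²-decay t N q≤q' 20≤n) +⁺⁰ <⇒≤ 0<x)
        (trans (+-congʳ (+-congˡ (+-congˡ (-‿cong (*-congʳ (fromℕ-+ 1 t))))))
          (solve 3 (λ b t x → (t :* x :- b) :+ (b :- (con (+ 1) :+ t) :* x) :+ x := con (+ 0)) refl ((fromℕ 1 + φ) * (fromℕ 1 + φ)) (fromℕ t) (error² δ δ')))
        where
        bound-t = archimedean* 0<x ((fromℕ 1 + φ) * (fromℕ 1 + φ))
        t = proj₁ bound-t

-- Boolean tests on integers.

∧-elim : ∀ a {b} → T (a ∧ b) → T a × T b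
∧-elim true b = tt , b

∨-elim : ∀ a {b} → T (a ∨ b) → T a ⊎ T b
∨-elim true  a = inj₁ a
∨-elim false b = inj₂ b

isPositive : ℤ → Bool
isPositive (+ suc _) = true
isPositive _         = false

-- A sufficient condition for 0 < a + b φ, by way of 8/5 < φ < 13/8.
positive : ℤ → ℤ → Bool
positive a (+ n)      = isPositive (+ 5 ℤ.* a ℤ.+ + 8 ℤ.* + n)
positive a (-[1+ n ]) = isPositive (+ 8 ℤ.* a ℤ.+ + 13 ℤ.* -[1+ n ])

-- (A , B , C) stands for (A + B φ) / C.
Surd : Set
Surd = ℤ × ℤ × ℕ

-- Whether δ = φ δ' holds at the given surd, that is θ (q + q' φ) = p + p' φ.
fits : ℕ → ℕ → ℕ → ℕ → Surd → Bool
fits p q p' q' (A , B , C) =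
  ⌊ A ℤ.* + q ℤ.+ B ℤ.* + q' ℤₚ.≟ + C ℤ.* + p ⌋ ∧ ⌊ A ℤ.* + q' ℤ.+ B ℤ.* (+ q ℤ.+ + q') ℤₚ.≟ + C ℤ.* + p' ⌋

-- (c , c') stands for c δ + c' δ' ≤ v.
Constraints : Set
Constraints = List (ℕ × ℕ)

-- Then c δ + c' δ' ≥ 19/10 (q δ' + q' δ) = 19/10 > v.
prunes : ℕ → ℕ → ℕ × ℕ → Bool
prunes q q' (c , c') = (19 ℕ.* q' ℕ.≤ᵇ 10 ℕ.* c) ∧ (19 ℕ.* q ℕ.≤ᵇ 10 ℕ.* c')

-- If δ = φ δ' then √5 (c δ + c' δ' − v) is δ' times the number tested here.
violates : ℕ → ℕ → ℕ × ℕ → Bool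
violates q q' (c , c') = positive
  (+ 2 ℤ.* + c ℤ.- + c' ℤ.- + q ℤ.- + 2 ℤ.* + q')
  (+ c ℤ.+ + 2 ℤ.* + c' ℤ.- + 2 ℤ.* + q ℤ.- + 3 ℤ.* + q')

-- These rewrite c δ + c' δ' in the variables of a child, by δ' = (δ' - δ) + δ or δ = (δ - δ') + δ',
-- or after exchanging the two neighbours.
leftward rightward flipped : ℕ × ℕ → ℕ × ℕ
leftward  (c , c') = c ℕ.+ c' , c'
rightward (c , c') = c , c ℕ.+ c'
flipped   (c , c') = c' , c

value : ℕ → ℕ → ℕ × ℕ
value q q' = q ℕ.+ q' ℕ.∸ 1 , q ℕ.+ q' ℕ.∸ 1

module _ (table : List Surd) where

  -- With q ≤ q' and q + q' ≥ 20 the alternation forces δ = φ δ', so one candidate θ is left below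
  -- the node. Either it breaks an inherited bound or it is in the table.
  ray : ℕ → ℕ → ℕ → ℕ → Constraints → Bool
  ray p q p' q' cs = (q ℕ.≤ᵇ q') ∧ (any (violates q q') cs ∨ any (fits p q p' q') table)

  -- Success means that no θ below the node, other than those in the table, has all its values at
  -- most v; failure means nothing. A value joins the constraints when a child is entered, so the
  -- root contributes none.
  search : ℕ → ℕ → ℕ → ℕ → ℕ → Constraints → Bool
  search zero       p q p' q' cs = false
  search (suc fuel) p q p' q' cs = any (prunes q q') cs ∨
    ((20 ℕ.≤ᵇ q ℕ.+ q') ∧ (ray p q p' q' cs ∨ ray p' q' p q (map flipped cs)) ∨
    (search fuel p q (p' ℕ.+ p) (q' ℕ.+ q) (value q (q' ℕ.+ q) ∷ map leftward cs) ∧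
     search fuel (p ℕ.+ p') (q ℕ.+ q') p' q' (value (q ℕ.+ q') q' ∷ map rightward cs)))

-- The number tested here is C √5 (v − (q + q' − 1)(δ + δ')), where C (δ + δ') = X + Y φ.
valueTest : ℕ → ℕ → ℕ → ℕ → Surd → Bool
valueTest p q p' q' (A , B , C) = positive (+ C ℤ.- n-1 ℤ.* (+ 2 ℤ.* Y ℤ.- X)) (+ 2 ℤ.* + C ℤ.- n-1 ℤ.* (+ 2 ℤ.* X ℤ.+ Y))
  where
  n-1 X Y : ℤ
  n-1 = + q ℤ.+ + q' ℤ.- + 1
  X = (+ q ℤ.- + q') ℤ.* A ℤ.+ (+ p' ℤ.- + p) ℤ.* + C
  Y = (+ q ℤ.- + q') ℤ.* B

-- Steers the walk; its answer is never relied upon.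
onLeft : ℕ → ℕ → ℕ → ℕ → Surd → Bool
onLeft p q p' q' (A , B , C) = positive (+ C ℤ.* (+ p' ℤ.+ + p) ℤ.- (+ q ℤ.+ + q') ℤ.* A) (ℤ.- ((+ q ℤ.+ + q') ℤ.* B))

-- The last two tests say − √5 φ³ < q φ − q' < √5 φ².
tail : ℕ → ℕ → ℕ → ℕ → Surd → Bool
tail p q p' q' surd = fits p q p' q' surd ∧ (positive (+ 1 ℤ.+ + q') (+ 3 ℤ.- + q) ∧ positive (+ 3 ℤ.- + q') (+ 4 ℤ.+ + q))

walk : ℕ → ℕ → ℕ → ℕ → ℕ → Surd → Bool
walk zero       p q p' q' surd = false
walk (suc fuel) p q p' q' surd = (tail p q p' q' surd ∨ tail p' q' p q surd) ∨
  (valueTest p q p' q' surd ∧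
    ((onLeft p q p' q' surd ∧ walk fuel p q (p' ℕ.+ p) (q' ℕ.+ q) surd) ∨ walk fuel (p ℕ.+ p') (q ℕ.+ q') p' q' surd))

above : Surd → Surd → Bool
above (A , B , C) (A' , B' , C') = positive (+ C' ℤ.* A ℤ.- + C ℤ.* A') (+ C' ℤ.* B ℤ.- + C ℤ.* B')

-- Soundness of the tests over the reals.

module Evaluation {c ℓ₁ ℓ₂ ℓ₃} (ℝ : RealNumbers c ℓ₁ ℓ₂ ℓ₃) where
  open OrderedField ℝ
  open Solver using (Polynomial; op; [+]; [*]; var; _:^_; ⟦_⟧) public
  open import Algebra.Properties.Semiring.Exp semiring using (_^_)

  _^ℤ_ : ℤ → ℕ → ℤ
  i ^ℤ zero  = + 1
  i ^ℤ suc n = i ℤ.* i ^ℤ n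

  -- At a concrete polynomial this unfolds to the integer expression inside a test, so `fromℤ-eval`
  -- carries the whole expression to the reals at once.
  evalℤ : ∀ {n} → Polynomial n → Vec ℤ n → ℤ
  evalℤ (op [+] p q) ρ = evalℤ p ρ ℤ.+ evalℤ q ρ
  evalℤ (op [*] p q) ρ = evalℤ p ρ ℤ.* evalℤ q ρ
  evalℤ (con i)      ρ = i
  evalℤ (var x)      ρ = lookup ρ x
  evalℤ (p :^ n)     ρ = evalℤ p ρ ^ℤ n
  evalℤ (:- p)       ρ = ℤ.- evalℤ p ρ

  fromℤ-eval : ∀ {n} (p : Polynomial n) ρ → fromℤ (evalℤ p ρ) ≈ ⟦ p ⟧ (Vec.map fromℤ ρ)
  fromℤ-eval (op [+] p q) ρ = trans (fromℤ-+ (evalℤ p ρ) (evalℤ q ρ)) (+-cong (fromℤ-eval p ρ) (fromℤ-eval q ρ))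
  fromℤ-eval (op [*] p q) ρ = trans (fromℤ-* (evalℤ p ρ) (evalℤ q ρ)) (*-cong (fromℤ-eval p ρ) (fromℤ-eval q ρ))
  fromℤ-eval (con i)      ρ = refl
  fromℤ-eval (var x)      ρ = reflexive (≡.sym (Vecₚ.lookup-map x fromℤ ρ))
  fromℤ-eval (p :^ n)     ρ = power n
    where
    power : ∀ n → fromℤ (evalℤ p ρ ^ℤ n) ≈ ⟦ p ⟧ (Vec.map fromℤ ρ) ^ n
    power zero    = fromℕ-1
    power (suc n) = trans (fromℤ-* (evalℤ p ρ) (evalℤ p ρ ^ℤ n)) (*-cong (fromℤ-eval p ρ) (power n))
  fromℤ-eval (:- p)       ρ = trans (fromℤ-neg (evalℤ p ρ)) (-‿cong (fromℤ-eval p ρ))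

module Certificates {c ℓ₁ ℓ₂ ℓ₃} (ℝ : RealNumbers c ℓ₁ ℓ₂ ℓ₃) (G : GoldenRatio ℝ) where
  open OrderedField ℝ
  open GoldenRatio G
  open LargestGap ℝ
  open Nodes ℝ
  open GoldenTail ℝ G
  open Evaluation ℝ

  private
    isPositive-sound : ∀ i → T (isPositive i) → 0# < fromℤ i
    isPositive-sound (+ suc n) _ = 0<fromℕ (suc n)

  positive-sound : ∀ a b → T (positive a b) → 0# < fromℤ a + fromℤ b * φ
  positive-sound a (+ n) t = 0<-cancelˡ (0<fromℕ 5) (<-respʳ-≈
    (solve 3 (λ a n φ → (con (+ 5) :* a :+ con (+ 8) :* n) :+ n :* (con (+ 5) :* φ :- con (+ 8)) := con (+ 5) :* (a :+ n :* φ)) refl (fromℤ a) (fromℕ n) φ)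
    (<-respʳ-≈ (fromℤ-eval (con (+ 5) :* var 0F :+ con (+ 8) :* var 1F) (a ∷ + n ∷ [])) (isPositive-sound _ t)
      +⁺⁰ 0≤fromℕ n *⁰⁰ <⇒≤ (<⇒0< 8<5φ)))
  positive-sound a -[1+ n ] t = 0<-cancelˡ (0<fromℕ 8) (<-respʳ-≈
    (solve 3 (λ a n φ → (con (+ 8) :* a :+ con (+ 13) :* (:- n)) :+ n :* (con (+ 13) :- con (+ 8) :* φ) := con (+ 8) :* (a :+ (:- n) :* φ)) refl (fromℤ a) (fromℕ (suc n)) φ)
    (<-respʳ-≈ (fromℤ-eval (con (+ 8) :* var 0F :+ con (+ 13) :* var 1F) (a ∷ -[1+ n ] ∷ [])) (isPositive-sound _ t)
      +⁺⁰ 0≤fromℕ (suc n) *⁰⁰ <⇒≤ (<⇒0< 8φ<13)))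

  -- Since v = (3 + 4 φ) / 5, the difference 19 - 10 v is 13 - 8 φ.
  v<19/10 : fromℕ 10 * v < fromℕ 19
  v<19/10 = 0<⇒< (sym (modulo {k = - (fromℕ 2 * (fromℕ 2 * φ - fromℕ 1))} v≈
      (modulo {k = fromℕ 8 * v - fromℕ 8} φ²≈
        (solve 2 (λ φ v → con (+ 19) :- con (+ 10) :* v := con (+ 13) :- con (+ 8) :* φ
            :+ (:- (con (+ 2) :* (con (+ 2) :* φ :- con (+ 1)))) :* ((con (+ 2) :* φ :- con (+ 1)) :* v :- (con (+ 2) :* φ :+ con (+ 1)))
            :+ (con (+ 8) :* v :- con (+ 8)) :* (φ :* φ :- (φ :+ con (+ 1)))) refl φ v))))
    (<⇒0< 8φ<13)

  _Is_ : Carrier → Surd → Set _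
  θ Is (A , B , C) = 0# < fromℕ C × fromℕ C * θ ≈ fromℤ A + fromℤ B * φ

  Is-unique : ∀ {θ θ' surd} → θ Is surd → θ' Is surd → θ ≈ θ'
  Is-unique (0<C , Cθ≈) (_ , Cθ'≈) = ≈-cancelˡ 0<C (trans Cθ≈ (sym Cθ'≈))

  above-sound : ∀ {θ θ'} S S' → θ Is S → θ' Is S' → T (above S S') → θ' < θ
  above-sound {θ} {θ'} (A , B , C) (A' , B' , C') (0<C , Cθ≈) (0<C' , C'θ'≈) t = 0<⇒< refl
    (0<-cancelˡ (0<C *⁺⁺ 0<C') (<-respʳ-≈ eq (positive-sound (+ C' ℤ.* A ℤ.- + C ℤ.* A') (+ C' ℤ.* B ℤ.- + C ℤ.* B') t)))
    where
    open import Relation.Binary.Reasoning.Setoid setoid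
    P : Polynomial 4
    P = var 0F :* var 1F :- var 2F :* var 3F
    eq : fromℤ (+ C' ℤ.* A ℤ.- + C ℤ.* A') + fromℤ (+ C' ℤ.* B ℤ.- + C ℤ.* B') * φ ≈ fromℕ C * fromℕ C' * (θ - θ')
    eq = begin
      fromℤ (+ C' ℤ.* A ℤ.- + C ℤ.* A') + fromℤ (+ C' ℤ.* B ℤ.- + C ℤ.* B') * φ
        ≈⟨ +-cong (fromℤ-eval P (+ C' ∷ A ∷ + C ∷ A' ∷ [])) (*-congʳ (fromℤ-eval P (+ C' ∷ B ∷ + C ∷ B' ∷ []))) ⟩
      fromℕ C' * fromℤ A - fromℕ C * fromℤ A' + (fromℕ C' * fromℤ B - fromℕ C * fromℤ B') * φ
        ≈⟨ solve 7 (λ A B C A' B' C' φ → C' :* A :- C :* A' :+ (C' :* B :- C :* B') :* φ := C' :* (A :+ B :* φ) :- C :* (A' :+ B' :* φ)) refl _ _ _ _ _ _ _ ⟩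
      fromℕ C' * (fromℤ A + fromℤ B * φ) - fromℕ C * (fromℤ A' + fromℤ B' * φ)
        ≈⟨ +-cong (*-congˡ Cθ≈) (-‿cong (*-congˡ C'θ'≈)) ⟨
      fromℕ C' * (fromℕ C * θ) - fromℕ C * (fromℕ C' * θ')
        ≈⟨ solve 4 (λ C C' θ θ' → C' :* (C :* θ) :- C :* (C' :* θ') := C :* C' :* (θ :- θ')) refl _ _ _ _ ⟩
      fromℕ C * fromℕ C' * (θ - θ') ∎

  fits-sound : ∀ p q p' q' A B C → T (fits p q p' q' (A , B , C)) →
    (fromℤ A + fromℤ B * φ) * (fromℕ q + fromℕ q' * φ) ≈ fromℕ C * (fromℕ p + fromℕ p' * φ)
  fits-sound p q p' q' A B C t = begin
    (fromℤ A + fromℤ B * φ) * (fromℕ q + fromℕ q' * φ)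
      ≈⟨ modulo {k = fromℤ B * fromℕ q'} φ²≈ (solve 5 (λ A B q q' φ → (A :+ B :* φ) :* (q :+ q' :* φ)
           := (A :* q :+ B :* q') :+ (A :* q' :+ B :* (q :+ q')) :* φ :+ B :* q' :* (φ :* φ :- (φ :+ con (+ 1)))) refl _ _ _ _ φ) ⟩
    (fromℤ A * fromℕ q + fromℤ B * fromℕ q') + (fromℤ A * fromℕ q' + fromℤ B * (fromℕ q + fromℕ q')) * φ
      ≈⟨ +-cong (trans (sym (fromℤ-eval (var 0F :* var 1F :+ var 2F :* var 3F) (A ∷ + q ∷ B ∷ + q' ∷ [])))
                       (trans (reflexive (≡.cong fromℤ (proj₁ both))) (fromℤ-* (+ C) (+ p))))
                (*-congʳ (trans (sym (fromℤ-eval (var 0F :* var 3F :+ var 2F :* (var 1F :+ var 3F)) (A ∷ + q ∷ B ∷ + q' ∷ [])))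
                       (trans (reflexive (≡.cong fromℤ (proj₂ both))) (fromℤ-* (+ C) (+ p'))))) ⟩
    fromℕ C * fromℕ p + fromℕ C * fromℕ p' * φ
      ≈⟨ solve 4 (λ C p p' φ → C :* p :+ C :* p' :* φ := C :* (p :+ p' :* φ)) refl _ _ _ _ ⟩
    fromℕ C * (fromℕ p + fromℕ p' * φ) ∎
    where
    open import Relation.Binary.Reasoning.Setoid setoid
    both : A ℤ.* + q ℤ.+ B ℤ.* + q' ≡ + C ℤ.* + p × A ℤ.* + q' ℤ.+ B ℤ.* (+ q ℤ.+ + q') ≡ + C ℤ.* + p'
    both with ∧-elim ⌊ A ℤ.* + q ℤ.+ B ℤ.* + q' ℤₚ.≟ + C ℤ.* + p ⌋ t
    ... | fst , snd = toWitness fst , toWitness snd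

  private
    0<ray : ∀ {q q'} → 1 ℕ.≤ q → 0# < fromℕ q + fromℕ q' * φ
    0<ray {suc q} {q'} _ = 0<fromℕ (suc q) +⁺⁰ 0≤fromℕ q' *⁰⁰ <⇒≤ 0<φ

  golden⇒Is : ∀ {θ p q p' q' A B C δ δ'} → 0# < fromℕ C → 1 ℕ.≤ q → δ ≈ fromℕ q * θ - fromℕ p → δ' ≈ fromℕ p' - fromℕ q' * θ →
    δ ≈ φ * δ' → T (fits p q p' q' (A , B , C)) → θ Is (A , B , C)
  golden⇒Is {θ} {p} {q} {p'} {q'} {A} {B} {C} {δ} {δ'} 0<C 1≤q δ≈ δ'≈ golden t = 0<C , ≈-cancelˡ (0<ray {q} {q'} 1≤q) (begin
    (fromℕ q + fromℕ q' * φ) * (fromℕ C * θ)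
      ≈⟨ solve 7 (λ q q' φ C θ p p' → (q :+ q' :* φ) :* (C :* θ) := C :* (p :+ p' :* φ :+ ((q :* θ :- p) :- φ :* (p' :- q' :* θ)))) refl _ _ _ _ _ (fromℕ p) (fromℕ p') ⟩
    fromℕ C * (fromℕ p + fromℕ p' * φ + ((fromℕ q * θ - fromℕ p) - φ * (fromℕ p' - fromℕ q' * θ)))
      ≈⟨ *-congˡ (+-congˡ (+-cong δ≈ (-‿cong (*-congˡ δ'≈)))) ⟨
    fromℕ C * (fromℕ p + fromℕ p' * φ + (δ - φ * δ'))
      ≈⟨ *-congˡ (+-congˡ (trans (+-congʳ golden) (-‿inverseʳ _))) ⟩
    fromℕ C * (fromℕ p + fromℕ p' * φ + 0#)
      ≈⟨ *-congˡ (+-identityʳ _) ⟩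
    fromℕ C * (fromℕ p + fromℕ p' * φ)
      ≈⟨ fits-sound p q p' q' A B C t ⟨
    (fromℤ A + fromℤ B * φ) * (fromℕ q + fromℕ q' * φ) ≈⟨ *-comm _ _ ⟩
    (fromℕ q + fromℕ q' * φ) * (fromℤ A + fromℤ B * φ) ∎)
    where open import Relation.Binary.Reasoning.Setoid setoid

  Is⇒golden : ∀ {θ p q p' q' A B C δ δ'} → θ Is (A , B , C) → δ ≈ fromℕ q * θ - fromℕ p → δ' ≈ fromℕ p' - fromℕ q' * θ →
    T (fits p q p' q' (A , B , C)) → δ ≈ φ * δ'
  Is⇒golden {θ} {p} {q} {p'} {q'} {A} {B} {C} {δ} {δ'} (0<C , Cθ≈) δ≈ δ'≈ t = ≈-cancelˡ 0<C (begin
    fromℕ C * δ ≈⟨ *-congˡ δ≈ ⟩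
    fromℕ C * (fromℕ q * θ - fromℕ p)
      ≈⟨ solve 7 (λ q q' φ C θ p p' → C :* (q :* θ :- p) := C :* (φ :* (p' :- q' :* θ)) :+ (C :* θ :* (q :+ q' :* φ) :- C :* (p :+ p' :* φ))) refl _ (fromℕ q') φ _ _ _ (fromℕ p') ⟩
    fromℕ C * (φ * (fromℕ p' - fromℕ q' * θ)) + (fromℕ C * θ * (fromℕ q + fromℕ q' * φ) - fromℕ C * (fromℕ p + fromℕ p' * φ))
      ≈⟨ +-cong (*-congˡ (*-congˡ (sym δ'≈))) (trans (+-congʳ (trans (*-congʳ Cθ≈) (fits-sound p q p' q' A B C t))) (-‿inverseʳ _)) ⟩
    fromℕ C * (φ * δ') + 0# ≈⟨ +-identityʳ _ ⟩
    fromℕ C * (φ * δ') ∎)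
    where open import Relation.Binary.Reasoning.Setoid setoid

  Holds : Carrier → Carrier → ℕ × ℕ → Set _
  Holds δ δ' (c , c') = fromℕ c * δ + fromℕ c' * δ' ≤ v

  leftward-holds : ∀ {δ δ'} s → Holds δ δ' s → Holds δ (δ' - δ) (leftward s)
  leftward-holds {δ} {δ'} (c , c') = ≤-respˡ-≈ (sym (trans (+-congʳ (*-congʳ (fromℕ-+ c c')))
    (solve 4 (λ c c' δ δ' → (c :+ c') :* δ :+ c' :* (δ' :- δ) := c :* δ :+ c' :* δ') refl (fromℕ c) (fromℕ c') δ δ')))

  rightward-holds : ∀ {δ δ'} s → Holds δ δ' s → Holds (δ - δ') δ' (rightward s)
  rightward-holds {δ} {δ'} (c , c') = ≤-respˡ-≈ (sym (trans (+-congˡ (*-congʳ (fromℕ-+ c c')))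
    (solve 4 (λ c c' δ δ' → c :* (δ :- δ') :+ (c :+ c') :* δ' := c :* δ :+ c' :* δ') refl (fromℕ c) (fromℕ c') δ δ')))

  flipped-holds : ∀ {δ δ'} s → Holds δ δ' s → Holds δ' δ (flipped s)
  flipped-holds (c , c') = ≤-respˡ-≈ (+-comm _ _)

  fromℕ-∸1 : ∀ {n} → 1 ℕ.≤ n → fromℕ (n ℕ.∸ 1) ≈ fromℕ n - fromℕ 1
  fromℕ-∸1 {suc n} _ = trans (solve 1 (λ n → n := con (+ 1) :+ n :- con (+ 1)) refl (fromℕ n)) (+-congʳ (sym (fromℕ-+ 1 n)))

  prunes-sound : ∀ {θ q q' δ δ'} s → Node± θ q q' δ δ' → Holds δ δ' s → T (prunes q q' s) → ⊥
  prunes-sound {q = q} {q'} {δ} {δ'} (c , c') N holds t with ∧-elim (19 ℕ.* q' ℕ.≤ᵇ 10 ℕ.* c) t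
  ... | 19q'≤10c , 19q≤10c' = absurd
    (<⇒0< v<19/10 +⁺⁰ 0≤fromℕ 10 *⁰⁰ ≤⇒0≤ holds
      +⁺⁰ ≤⇒0≤ (scaled q' c 19q'≤10c) *⁰⁰ <⇒≤ (proj₁ (0<δ,δ' N)) +⁺⁰ ≤⇒0≤ (scaled q c' 19q≤10c') *⁰⁰ <⇒≤ (proj₂ (0<δ,δ' N)))
    (modulo {k = - fromℕ 19} (unit± N) (solve 7 (λ q q' δ δ' v c c' →
      (con (+ 19) :- con (+ 10) :* v) :+ con (+ 10) :* (v :- (c :* δ :+ c' :* δ'))
        :+ (con (+ 10) :* c :- con (+ 19) :* q') :* δ :+ (con (+ 10) :* c' :- con (+ 19) :* q) :* δ'
      := con (+ 0) :+ (:- con (+ 19)) :* (q :* δ' :+ q' :* δ :- con (+ 1))) refl (fromℕ q) (fromℕ q') δ δ' v (fromℕ c) (fromℕ c')))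
    where
    scaled : ∀ m n → T (19 ℕ.* m ℕ.≤ᵇ 10 ℕ.* n) → fromℕ 19 * fromℕ m ≤ fromℕ 10 * fromℕ n
    scaled m n t = ≤-respˡ-≈ (fromℕ-* 19 m) (≤-respʳ-≈ (fromℕ-* 10 n) (fromℕ-mono (ℕₚ.≤ᵇ⇒≤ (19 ℕ.* m) (10 ℕ.* n) t)))

  violates-sound : ∀ {θ q q' δ δ'} s → Node± θ q q' δ δ' → δ ≈ φ * δ' → Holds δ δ' s → T (violates q q' s) → ⊥
  violates-sound {q = q} {q'} {δ} {δ'} (c , c') N golden holds t = absurd
    (positive-sound x y t *⁺⁺ proj₂ (0<δ,δ' N) +⁺⁰ <⇒≤ 0<2φ-1 *⁰⁰ ≤⇒0≤ (≤-respˡ-≈ (+-congʳ (*-congˡ golden)) holds))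
    (trans (+-congʳ (*-congʳ (+-cong (fromℤ-eval X ρ) (*-congʳ (fromℤ-eval Y ρ)))))
      (modulo {k = fromℕ 1} v≈ (modulo {k = - (fromℕ 2 * φ + fromℕ 1)} (golden-unit N golden) (modulo {k = δ' * (fromℕ 2 * fromℕ q' - fromℕ 2 * fromℕ c)} φ²≈
        (solve 7 (λ c c' q q' φ δ' v →
          ((con (+ 2) :* c :- c' :- q :- con (+ 2) :* q') :+ (c :+ con (+ 2) :* c' :- con (+ 2) :* q :- con (+ 3) :* q') :* φ) :* δ'
            :+ (con (+ 2) :* φ :- con (+ 1)) :* (v :- (c :* (φ :* δ') :+ c' :* δ'))
          := con (+ 0) :+ con (+ 1) :* ((con (+ 2) :* φ :- con (+ 1)) :* v :- (con (+ 2) :* φ :+ con (+ 1)))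
            :+ (:- (con (+ 2) :* φ :+ con (+ 1))) :* ((q :+ q' :* φ) :* δ' :- con (+ 1))
            :+ (δ' :* (con (+ 2) :* q' :- con (+ 2) :* c)) :* (φ :* φ :- (φ :+ con (+ 1))))
          refl (fromℕ c) (fromℕ c') (fromℕ q) (fromℕ q') φ δ' v)))))
    where
    x = + 2 ℤ.* + c ℤ.- + c' ℤ.- + q ℤ.- + 2 ℤ.* + q'
    y = + c ℤ.+ + 2 ℤ.* + c' ℤ.- + 2 ℤ.* + q ℤ.- + 3 ℤ.* + q'
    ρ : Vec ℤ 4
    ρ = + c ∷ + c' ∷ + q ∷ + q' ∷ []
    X Y : Polynomial 4
    X = con (+ 2) :* var 0F :- var 1F :- var 2F :- con (+ 2) :* var 3F
    Y = var 0F :+ con (+ 2) :* var 1F :- con (+ 2) :* var 2F :- con (+ 3) :* var 3F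

  value-holds : ∀ {θ q q' δ δ'} → UpperBound θ v → Node± θ q q' δ δ' → 3 ℕ.≤ q ℕ.+ q' → Holds δ δ' (value q q')
  value-holds {q = q} {q'} {δ} {δ'} bound N 3≤n = ≤-respˡ-≈
    (trans (distribˡ _ δ δ') (+-cong (*-congʳ n-1≈) (*-congʳ n-1≈))) (node-value≤ bound N 3≤n)
    where
    n-1≈ : fromℕ q + fromℕ q' - fromℕ 1 ≈ fromℕ (q ℕ.+ q' ℕ.∸ 1)
    n-1≈ = sym (trans (fromℕ-∸1 (ℕₚ.≤-trans (s≤s z≤n) 3≤n)) (+-congʳ (fromℕ-+ q q')))

  private
      negate-sub : ∀ {x a b} → x ≈ a - b → - x ≈ b - a
      negate-sub {x} {a} {b} x≈ = trans (-‿cong x≈) (solve 2 (λ a b → :- (a :- b) := b :- a) refl a b)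

  -- The orbit of a rational θ is finite modulo 1, so a gap of length δ' survives for all m, and its
  -- multiples by m + 1 exceed v.
  rational-unbounded : ∀ {θ p q p' q' δ δ'} → FareyPair θ p q p' q' δ δ' → δ ≈ 0# → 0# < δ' → q' ℕ.≤ q → UpperBound θ v → ⊥
  rational-unbounded {θ} {q = q} {δ = δ} {δ'} pair δ≈0 0<δ' q'≤q bound = absurd
    (<⇒0< v<nδ' +⁺⁰ ≤⇒0≤ (bound {n ℕ.+ q} 1≤m (Is-d-rational pair δ≈0 0<δ' q'≤q (ℕₚ.m≤n⇒m≤1+n (ℕₚ.m≤n+m q n)))) +⁺⁰ 0≤fromℕ (1 ℕ.+ q) *⁰⁰ <⇒≤ 0<δ')
    (trans (+-congʳ (+-congˡ (+-congˡ (-‿cong (*-congʳ size≈)))))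
      (modulo {k = - (fromℕ n + fromℕ (1 ℕ.+ q))} δ≈0
        (solve 5 (λ n q v δ δ' → (n :* δ' :- v) :+ (v :- (n :+ q) :* (δ :+ δ')) :+ q :* δ' := con (+ 0) :+ (:- (n :+ q)) :* (δ :- con (+ 0))) refl (fromℕ n) (fromℕ (1 ℕ.+ q)) v δ δ')))
    where
    n = proj₁ (archimedean* 0<δ' v)
    v<nδ' = proj₂ (archimedean* 0<δ' v)
    1≤m : 1 ℕ.≤ n ℕ.+ q
    1≤m = ℕₚ.≤-trans (FareyPair.1≤q pair) (ℕₚ.m≤n+m q n)
    size≈ : fromℕ (suc (n ℕ.+ q)) ≈ fromℕ n + fromℕ (1 ℕ.+ q)
    size≈ = trans (reflexive (≡.cong fromℕ (≡.sym (ℕₚ.+-suc n q)))) (fromℕ-+ n (1 ℕ.+ q))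

  module _ {θ : Carrier} (bound : UpperBound θ v) (table : List Surd)
    (excluded : All (λ S → 0# < fromℕ (proj₂ (proj₂ S)) × ¬ θ Is S) table) where

    private
      contradict : ∀ {p q p' q' δ δ'} → 1 ℕ.≤ q → δ ≈ fromℕ q * θ - fromℕ p → δ' ≈ fromℕ p' - fromℕ q' * θ → δ ≈ φ * δ' →
        ∀ {S} → (0# < fromℕ (proj₂ (proj₂ S)) × ¬ θ Is S) × T (fits p q p' q' S) → ⊥
      contradict {p} {q} {p'} {q'} 1≤q δ≈ δ'≈ golden {A , B , C} ((0<C , θ-isn't) , t) = θ-isn't
        (golden⇒Is {p = p} {q} {p'} {q'} {A} {B} {C} 0<C 1≤q δ≈ δ'≈ golden t)

      -- With the neighbours exchanged, the formulas q θ - p and p' - q' θ produce -δ' and -δ. The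
      -- pair `ε`, `ε'` absorbs this sign, to which the golden relation is insensitive.
      ray-sound : ∀ {p q p' q' δ δ' ε ε'} cs → Node± θ q q' δ δ' → All (Holds δ δ') cs → 20 ℕ.≤ q ℕ.+ q' →
        (δ ≈ φ * δ' → ε ≈ φ * ε') → ε ≈ fromℕ q * θ - fromℕ p → ε' ≈ fromℕ p' - fromℕ q' * θ →
        T (ray table p q p' q' cs) → ⊥
      ray-sound {p} {q} {p'} {q'} {δ} {δ'} cs N holds 20≤n transfer ε≈ ε'≈ t with ∧-elim (q ℕ.≤ᵇ q') t
      ... | q≤q' , t' = cases (∨-elim (any (violates q q') cs) t')
        where
        golden : δ ≈ φ * δ'
        golden = eventually-golden bound v<19/10 N (ℕₚ.≤ᵇ⇒≤ q q' q≤q') 20≤n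
        cases : T (any (violates q q') cs) ⊎ T (any (fits p q p' q') table) → ⊥
        cases (inj₁ a) = let (h , t) = All.lookupAny holds (Anyₚ.any⁻ _ cs a) in violates-sound (Any.lookup (Anyₚ.any⁻ (violates q q') cs a)) N golden h t
        cases (inj₂ a) = contradict {p} {q} {p'} {q'} (proj₁ (1≤q,q' N)) ε≈ ε'≈ (transfer golden)
          {Any.lookup (Anyₚ.any⁻ _ table a)} (All.lookupAny excluded (Anyₚ.any⁻ (fits p q p' q') table a))

      negate : ∀ {x y} → x ≈ φ * y → - x ≈ φ * - y
      negate {x} {y} x≈ = trans (-‿cong x≈) (solve 2 (λ φ y → :- (φ :* y) := φ :* (:- y)) refl φ y)

    search-sound : ∀ fuel {p q p' q' δ δ'} cs → Node θ p q p' q' δ δ' → All (Holds δ δ') cs → T (search table fuel p q p' q' cs) → ⊥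
    search-sound (suc fuel) {p} {q} {p'} {q'} {δ} {δ'} cs N@(node pair 0<δ 0<δ') holds t = cases (∨-elim (any (prunes q q') cs) t)
      where
      open FareyPair pair
      N± : Node± θ q q' δ δ'
      N± = node⁺ N
      deep : Bool
      deep = (20 ℕ.≤ᵇ q ℕ.+ q') ∧ (ray table p q p' q' cs ∨ ray table p' q' p q (map flipped cs))
      left right : Bool
      left = search table fuel p q (p' ℕ.+ p) (q' ℕ.+ q) (value q (q' ℕ.+ q) ∷ map leftward cs)
      right = search table fuel (p ℕ.+ p') (q ℕ.+ q') p' q' (value (q ℕ.+ q') q' ∷ map rightward cs)

      on-ray : 20 ℕ.≤ q ℕ.+ q' → T (ray table p q p' q' cs) ⊎ T (ray table p' q' p q (map flipped cs)) → ⊥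
      on-ray 20≤n (inj₁ t) = ray-sound {p} {q} {p'} {q'} cs N± holds 20≤n (λ g → g) δ≈ δ'≈ t
      on-ray 20≤n (inj₂ t) = ray-sound {p'} {q'} {p} {q} (map flipped cs) (swap N±) (Allₚ.map⁺ (All.map (λ {s} → flipped-holds s) holds))
        (≡.subst (20 ℕ.≤_) (ℕₚ.+-comm q q') 20≤n) negate (negate-sub δ'≈) (negate-sub δ≈) t

      descend : T left → T right → ⊥
      descend tl tr = compare {δ} {δ'}
        (λ δ<δ' → let N' = leftChild N δ<δ' in
          search-sound fuel (value q (q' ℕ.+ q) ∷ map leftward cs) N' (value-holds bound (node⁺ N') (ℕₚ.+-mono-≤ 1≤q (ℕₚ.+-mono-≤ 1≤q' 1≤q))
            ∷ Allₚ.map⁺ (All.map (λ {s} → leftward-holds s) holds)) tl)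
        -- Equality places θ at the mediant, so θ is rational.
        (λ δ≈δ' → rational-unbounded (rightPair pair) (trans (+-congʳ δ≈δ') (-‿inverseʳ δ')) 0<δ' (ℕₚ.m≤n+m q' q) bound)
        (λ δ'<δ → let N' = rightChild N δ'<δ in
          search-sound fuel (value (q ℕ.+ q') q' ∷ map rightward cs) N' (value-holds bound (node⁺ N') (ℕₚ.+-mono-≤ {2} (ℕₚ.+-mono-≤ 1≤q 1≤q') 1≤q')
            ∷ Allₚ.map⁺ (All.map (λ {s} → rightward-holds s) holds)) tr)

      cases : T (any (prunes q q') cs) ⊎ T (deep ∨ (left ∧ right)) → ⊥
      cases (inj₁ a) = let (h , t) = All.lookupAny holds (Anyₚ.any⁻ (prunes q q') cs a) in prunes-sound (Any.lookup (Anyₚ.any⁻ (prunes q q') cs a)) N± h t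
      cases (inj₂ t) with ∨-elim deep t
      ... | inj₁ d = let (n≥20 , r) = ∧-elim (20 ℕ.≤ᵇ q ℕ.+ q') d in
        on-ray (ℕₚ.≤ᵇ⇒≤ 20 (q ℕ.+ q') n≥20) (∨-elim (ray table p q p' q' cs) r)
      ... | inj₂ lr = let (l , r) = ∧-elim left lr in descend l r

  -- This is what travels from the golden tail up to the root, where q = q' = 1 and `bounded` covers
  -- every m.
  record Extremal (θ : Carrier) (q q' : ℕ) (δ δ' : Carrier) : Set (c ⊔ ℓ₁ ⊔ ℓ₂ ⊔ ℓ₃) where
    field
      0<δ     : 0# < δ
      0<δ'    : 0# < δ'
      bounded : ∀ {m I} → q ℕ.≤ suc m → q' ℕ.≤ suc m → Avoids θ m I → fromℕ (suc m) * ∣ I ∣ ≤ v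
      sup     : ∀ {u} → UpperBound θ u → u < v → ⊥

  tail-sound : ∀ {θ q q' δ δ'} → Node± θ q q' δ δ' → δ ≈ φ * δ' →
    T (positive (+ 1 ℤ.+ + q') (+ 3 ℤ.- + q) ∧ positive (+ 3 ℤ.- + q') (+ 4 ℤ.+ + q)) → Extremal θ q q' δ δ'
  tail-sound {q = q} {q'} N golden t = record
    { 0<δ     = proj₁ (0<δ,δ' N)
    ; 0<δ'    = proj₂ (0<δ,δ' N)
    ; bounded = λ {m} {I} q≤ q'≤ avoids → golden-bound (suc m) {I = I} N golden g≤ -g≤ q≤ q'≤ (ℕₚ.m<n+m (suc m) (ℕₚ.+-mono-≤ {1} {q} {0} (proj₁ (1≤q,q' N)) z≤n)) avoids
    ; sup     = λ bound u<v → golden-sup bound u<v N golden g≤ -g≤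
    }
    where
    both = ∧-elim (positive (+ 1 ℤ.+ + q') (+ 3 ℤ.- + q)) t
    g≤ : fromℕ q * φ - fromℕ q' ≤ fromℕ 3 * φ + fromℕ 1
    g≤ = 0≤⇒≤ (trans (+-cong (fromℤ-+ (+ 1) (+ q')) (*-congʳ (fromℤ-eval (con (+ 3) :- var 0F) (+ q ∷ []))))
        (solve 3 (λ q q' φ → con (+ 1) :+ q' :+ (con (+ 3) :- q) :* φ := con (+ 3) :* φ :+ con (+ 1) :- (q :* φ :- q')) refl (fromℕ q) (fromℕ q') φ))
      (<⇒≤ (positive-sound (+ 1 ℤ.+ + q') (+ 3 ℤ.- + q) (proj₁ both)))
    -g≤ : - (fromℕ q * φ - fromℕ q') ≤ fromℕ 4 * φ + fromℕ 3
    -g≤ = 0≤⇒≤ (trans (+-cong (fromℤ-eval (con (+ 3) :- var 0F) (+ q' ∷ [])) (*-congʳ (fromℤ-+ (+ 4) (+ q))))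
        (solve 3 (λ q q' φ → con (+ 3) :- q' :+ (con (+ 4) :+ q) :* φ := con (+ 4) :* φ :+ con (+ 3) :- (:- (q :* φ :- q'))) refl (fromℕ q) (fromℕ q') φ))
      (<⇒≤ (positive-sound (+ 3 ℤ.- + q') (+ 4 ℤ.+ + q) (proj₂ both)))

  flip-extremal : ∀ {θ q q' δ δ'} → Extremal θ q' q δ' δ → Extremal θ q q' δ δ'
  flip-extremal E = record { 0<δ = 0<δ' ; 0<δ' = 0<δ ; bounded = λ {m} {I} q≤ q'≤ → bounded {m} {I} q'≤ q≤ ; sup = sup }
    where open Extremal E

  module _ {θ : Carrier} {A B : ℤ} {C : ℕ} (is : θ Is (A , B , C)) where

    private
      surd : Surd
      surd = A , B , C
      0<C = proj₁ is
      Cθ≈ = proj₂ is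

      golden-positive : ∀ {q q' δ δ'} → 1 ℕ.≤ q → fromℕ q * δ' + fromℕ q' * δ ≈ fromℕ 1 → δ ≈ φ * δ' → 0# < δ × 0# < δ'
      golden-positive {q} {q'} {δ} {δ'} 1≤q unit golden = <-respʳ-≈ (sym golden) (0<φ *⁺⁺ 0<δ') , 0<δ'
        where
        0<δ' : 0# < δ'
        0<δ' = 0<-cancelˡ (0<ray {q} {q'} 1≤q) (<-respʳ-≈ (sym (trans
          (solve 4 (λ q q' φ δ' → (q :+ q' :* φ) :* δ' := q :* δ' :+ q' :* (φ :* δ')) refl (fromℕ q) (fromℕ q') φ δ')
          (trans (+-congˡ (*-congˡ (sym golden))) unit))) (0<fromℕ 1))

    valueTest-sound : ∀ p q p' q' {δ δ'} → FareyPair θ p q p' q' δ δ' → T (valueTest p q p' q' surd) →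
      (fromℕ q + fromℕ q' - fromℕ 1) * (δ + δ') ≤ v
    valueTest-sound p q p' q' {δ} {δ'} pair t = 0≤⇒≤ refl (0≤-cancelˡ (0<2φ-1 *⁺⁺ 0<C) (<⇒≤ (<-respʳ-≈
      (trans (+-cong (fromℤ-eval P ρ) (*-congʳ (fromℤ-eval R ρ)))
        (sym (trans (*-congˡ (+-congˡ (-‿cong (*-congˡ (+-cong δ≈ δ'≈)))))
          (modulo {k = fromℕ C} v≈ (modulo {k = - ((fromℕ 2 * φ - fromℕ 1) * (Q + Q' - fromℕ 1) * (Q - Q'))} Cθ≈ (modulo {k = - (fromℕ 2 * (Q + Q' - fromℕ 1) * ((Q - Q') * fromℤ B))} φ²≈
            (solve 10 (λ p q p' q' A B C θ φ v →
              (con (+ 2) :* φ :- con (+ 1)) :* C :* (v :- (q :+ q' :- con (+ 1)) :* ((q :* θ :- p) :+ (p' :- q' :* θ)))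
              := (C :- (q :+ q' :- con (+ 1)) :* (con (+ 2) :* ((q :- q') :* B) :- ((q :- q') :* A :+ (p' :- p) :* C)))
                   :+ (con (+ 2) :* C :- (q :+ q' :- con (+ 1)) :* (con (+ 2) :* ((q :- q') :* A :+ (p' :- p) :* C) :+ (q :- q') :* B)) :* φ
                 :+ C :* ((con (+ 2) :* φ :- con (+ 1)) :* v :- (con (+ 2) :* φ :+ con (+ 1)))
                 :+ (:- ((con (+ 2) :* φ :- con (+ 1)) :* (q :+ q' :- con (+ 1)) :* (q :- q'))) :* (C :* θ :- (A :+ B :* φ))
                 :+ (:- (con (+ 2) :* (q :+ q' :- con (+ 1)) :* ((q :- q') :* B))) :* (φ :* φ :- (φ :+ con (+ 1))))
              refl (fromℕ p) Q (fromℕ p') Q' (fromℤ A) (fromℤ B) (fromℕ C) θ φ v)))))))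
      (positive-sound (evalℤ P ρ) (evalℤ R ρ) t))))
      where
      open FareyPair pair
      Q Q' : Carrier
      Q = fromℕ q
      Q' = fromℕ q'
      ρ : Vec ℤ 7
      ρ = + p ∷ + q ∷ + p' ∷ + q' ∷ A ∷ B ∷ + C ∷ []
      n-1 X Y P R : Polynomial 7
      n-1 = var 1F :+ var 3F :- con (+ 1)
      X = (var 1F :- var 3F) :* var 4F :+ (var 2F :- var 0F) :* var 6F
      Y = (var 1F :- var 3F) :* var 5F
      P = var 6F :- n-1 :* (con (+ 2) :* Y :- X)
      R = con (+ 2) :* var 6F :- n-1 :* (con (+ 2) :* X :+ Y)

    -- Signs are established from the bottom up: at a golden node the unit relation makes δ and δ'
    -- positive, and a parent's δ and δ' are obtained from its child's by addition. This also
    -- confirms each turn after the fact, so the steering test may be unverified.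
    walk-sound : ∀ fuel {p q p' q' δ δ'} → FareyPair θ p q p' q' δ δ' → T (walk fuel p q p' q' surd) → Extremal θ q q' δ δ'
    walk-sound (suc fuel) {p} {q} {p'} {q'} {δ} {δ'} pair t with ∨-elim (tail p q p' q' surd ∨ tail p' q' p q surd) t
    ... | inj₁ ends = at-end (∨-elim (tail p q p' q' surd) ends)
      where
      open FareyPair pair
      at-end : T (tail p q p' q' surd) ⊎ T (tail p' q' p q surd) → Extremal θ q q' δ δ'
      at-end (inj₁ t) = let (f , pos) = ∧-elim (fits p q p' q' surd) t
                            golden = Is⇒golden {p = p} {q} {p'} {q'} {A} {B} {C} is δ≈ δ'≈ f
                            (0<δ , 0<δ') = golden-positive {q} {q'} 1≤q unit golden
                        in tail-sound (node⁺ (node pair 0<δ 0<δ')) golden pos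
      at-end (inj₂ t) = let (f , pos) = ∧-elim (fits p' q' p q surd) t
                            golden = unnegate (Is⇒golden {p = p'} {q'} {p} {q} {A} {B} {C} is (negate-sub δ'≈) (negate-sub δ≈) f)
                            (0<δ' , 0<δ) = golden-positive {q'} {q} 1≤q' (trans (+-comm _ _) unit) golden
                        in flip-extremal (tail-sound (node⁻ (node pair 0<δ 0<δ')) golden pos)
        where
        unnegate : ∀ {x y} → - x ≈ φ * - y → x ≈ φ * y
        unnegate {x} {y} eq = trans (solve 1 (λ x → x := :- (:- x)) refl x) (trans (-‿cong eq) (solve 2 (λ φ y → :- (φ :* (:- y)) := φ :* y) refl φ y))
    ... | inj₂ rest with ∧-elim (valueTest p q p' q' surd) rest
    ...   | ok , down with ∨-elim (onLeft p q p' q' surd ∧ walk fuel p q (p' ℕ.+ p) (q' ℕ.+ q) surd) down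
    ...     | inj₁ l = record
      { 0<δ     = E.0<δ
      ; 0<δ'    = 0<δ'
      ; bounded = λ {m} {I} → bounded {m} {I}
      ; sup     = E.sup
      }
      where
      E : Extremal θ q (q' ℕ.+ q) δ (δ' - δ)
      E = walk-sound fuel (leftPair pair) (proj₂ (∧-elim (onLeft p q p' q' surd) l))
      module E = Extremal E
      0<δ' : 0# < δ'
      0<δ' = <-respʳ-≈ (solve 2 (λ δ δ' → δ :+ (δ' :- δ) := δ') refl δ δ') (E.0<δ +⁺⁺ E.0<δ')
      bounded : ∀ {m I} → q ℕ.≤ suc m → q' ℕ.≤ suc m → Avoids θ m I → fromℕ (suc m) * ∣ I ∣ ≤ v
      bounded {m} {I} q≤ q'≤ avoids with q' ℕ.+ q ℕₚ.≤? suc m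
      ... | yes n≤ = E.bounded {m} {I} q≤ n≤ avoids
      ... | no n≰  = interval-bound {I = I} (node⁺ (node pair E.0<δ 0<δ')) (valueTest-sound p q p' q' pair ok) q≤ q'≤
        (≡.subst (suc m ℕ.<_) (ℕₚ.+-comm q' q) (ℕₚ.≰⇒> n≰)) avoids
    ...     | inj₂ r = record
      { 0<δ     = 0<δ
      ; 0<δ'    = E.0<δ'
      ; bounded = λ {m} {I} → bounded {m} {I}
      ; sup     = E.sup
      }
      where
      E : Extremal θ (q ℕ.+ q') q' (δ - δ') δ'
      E = walk-sound fuel (rightPair pair) r
      module E = Extremal E
      0<δ : 0# < δ
      0<δ = <-respʳ-≈ (solve 2 (λ δ δ' → δ' :+ (δ :- δ') := δ) refl δ δ') (E.0<δ' +⁺⁺ E.0<δ)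
      bounded : ∀ {m I} → q ℕ.≤ suc m → q' ℕ.≤ suc m → Avoids θ m I → fromℕ (suc m) * ∣ I ∣ ≤ v
      bounded {m} {I} q≤ q'≤ avoids with q ℕ.+ q' ℕₚ.≤? suc m
      ... | yes n≤ = E.bounded {m} {I} n≤ q'≤ avoids
      ... | no n≰  = interval-bound {I = I} (node⁺ (node pair 0<δ E.0<δ')) (valueTest-sound p q p' q' pair ok) q≤ q'≤ (ℕₚ.≰⇒> n≰) avoids

-- The sixteen numbers and the computations about them.

-- By √5 = 2 φ - 1, a + √5 is (a - 1) + 2 φ and a - √5 is (a + 1) - 2 φ. Denominators are left
-- unreduced to agree with `η`.
ηSurd : Fin 8 → Surd
ηSurd 0F = + 12 , + 2 , 82
ηSurd 1F = + 8 , ℤ.- + 2 , 22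
ηSurd 2F = + 10 , + 2 , 58
ηSurd 3F = + 6 , ℤ.- + 2 , 10
ηSurd 4F = + 8 , + 2 , 38
ηSurd 5F = + 26 , ℤ.- + 2 , 62
ηSurd 6F = + 4 , ℤ.- + 2 , 2
ηSurd 7F = + 6 , + 2 , 22

1-surd : Surd → Surd
1-surd (A , B , C) = + C ℤ.- A , ℤ.- B , C

extremalSurd : Fin 16 → Surd
extremalSurd j = [ ηSurd , (λ i → 1-surd (ηSurd i)) ] (splitAt 8 j)

table : List Surd
table = List.tabulate extremalSurd

search-succeeds : T (search table 10 0 1 1 1 [])
search-succeeds = tt

walk-succeeds : ∀ j → T (walk 6 0 1 1 1 (extremalSurd j))
walk-succeeds = toWitness {a? = Finₚ.all? λ j → T? (walk 6 0 1 1 1 (extremalSurd j))} tt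

extremal-positive : ∀ j → T (above (extremalSurd j) (+ 0 , + 0 , 1))
extremal-positive = toWitness {a? = Finₚ.all? λ j → T? (above (extremalSurd j) (+ 0 , + 0 , 1))} tt

-- The bound 9/10 serves as a rational strictly between all sixteen numbers and 1; the room up to 1
-- is what later lets one comparison fix the integer part of θ.
extremal<9/10 : ∀ j → T (above (+ 9 , + 0 , 10) (extremalSurd j))
extremal<9/10 = toWitness {a? = Finₚ.all? λ j → T? (above (+ 9 , + 0 , 10) (extremalSurd j))} tt

extremal-separated : ∀ i j → T (⌊ i Finₚ.≟ j ⌋ ∨ (above (extremalSurd i) (extremalSurd j) ∨ above (extremalSurd j) (extremalSurd i)))
extremal-separated = toWitness {a? = Finₚ.all? λ i → Finₚ.all? λ j →
  T? (⌊ i Finₚ.≟ j ⌋ ∨ (above (extremalSurd i) (extremalSurd j) ∨ above (extremalSurd j) (extremalSurd i)))} tt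

-- Division, and locating a real number by comparisons.

module Division {c ℓ₁ ℓ₂ ℓ₃} (ℝ : RealNumbers c ℓ₁ ℓ₂ ℓ₃) where
  open OrderedField ℝ

  ÷-cancel : ∀ x y (0<y : 0# < y) → y * (x ÷ y [ 0<y ]) ≈ x
  ÷-cancel x y 0<y = trans (*-comm y _) (trans (*-assoc x _ y) (trans (*-congˡ (trans (*-congˡ (sym (x-0≈x y))) (proj₁ (proj₂ (#⇒invertible (#-sym (<⇒# 0<y))))))) (*-identityʳ x)))

module Location {c ℓ₁ ℓ₂ ℓ₃} (ℝ : RealNumbers c ℓ₁ ℓ₂ ℓ₃) where
  open OrderedField ℝ

  -- Comparing x with two candidates that are apart discards one of them.
  select : ∀ {x} n (f : Fin (suc n) → Carrier) → (∀ i j → i ≢ j → f i # f j) → ¬ (∀ j → ¬ x ≈ f j) → ∃[ j ] x ≈ f j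
  select zero    f apart ¬¬∃ = 0F , proj₁ (tight _ _) λ x#f0 → ¬¬∃ λ { 0F x≈f0 → #-irrefl x≈f0 x#f0 }
  select {x} (suc n) f apart ¬¬∃ with #-cotrans (apart 0F 1F λ ()) x
  ... | inj₁ f0#x with select n (f ∘ Fin.suc) (λ i j i≢j → apart _ _ (i≢j ∘ Finₚ.suc-injective))
                       (λ none → ¬¬∃ λ { 0F x≈f0 → #-irrefl (sym x≈f0) f0#x ; (Fin.suc j) → none j })
  ...   | j , x≈fj = Fin.suc j , x≈fj
  select {x} (suc n) f apart ¬¬∃ | inj₂ x#f1 with select n (f ∘ punchIn 1F) (λ i j i≢j → apart _ _ (i≢j ∘ Finₚ.punchIn-injective 1F i j))
                       (λ none → ¬¬∃ (other none))
    where
    other : (∀ j → ¬ x ≈ f (punchIn 1F j)) → ∀ j → ¬ x ≈ f j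
    other none j x≈fj with 1F Finₚ.≟ j
    ... | yes ≡.refl = #-irrefl x≈fj x#f1
    ... | no 1≢j     = none (punchOut 1≢j) (≡.subst (λ i → x ≈ f i) (≡.sym (Finₚ.punchIn-punchOut 1≢j)) x≈fj)
  ...   | j , x≈fj = punchIn 1F j , x≈fj

  -- The floor is not computable from a real number, but a window of length 2 is: windows for
  -- consecutive k overlap, so cotransitivity can decide between them.
  locate : ∀ x → ∃[ k ] fromℤ k < x × x < fromℤ k + fromℕ 2
  locate x = loop (n ℕ.+ m) (ℤ.- + n) start end
    where
    n m : ℕ
    n = proj₁ (archimedean (- x))
    m = proj₁ (archimedean x)
    start : fromℤ (ℤ.- + n) < x
    start = <-respˡ-≈ (sym (fromℤ-neg (+ n))) (0<⇒< (solve 2 (λ n x → n :- :- x := x :- :- n) refl (fromℕ n) x) (<⇒0< (proj₂ (archimedean (- x)))))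
    end : x < fromℤ (ℤ.- + n) + fromℕ (n ℕ.+ m)
    end = <-respʳ-≈ (trans (solve 2 (λ n m → m := :- n :+ (n :+ m)) refl (fromℕ n) (fromℕ m)) (sym (+-cong (fromℤ-neg (+ n)) (fromℕ-+ n m)))) (proj₂ (archimedean x))
    loop : ∀ s k → fromℤ k < x → x < fromℤ k + fromℕ s → ∃[ k ] fromℤ k < x × x < fromℤ k + fromℕ 2
    loop zero k k<x x<k = ⊥-elim (<-asym k<x (<-respʳ-≈ (+-identityʳ _) x<k))
    loop (suc s) k k<x x<k+s with <-cotrans {fromℤ k + fromℕ 1} {fromℤ k + fromℕ 2} (0<⇒< (solve 1 (λ k → con (+ 1) := k :+ con (+ 2) :- (k :+ con (+ 1))) refl (fromℤ k)) (0<fromℕ 1)) x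
    ... | inj₂ x<k+2 = k , k<x , x<k+2
    ... | inj₁ k+1<x = loop s (k ℤ.+ + 1) (<-respˡ-≈ (sym (fromℤ-+ k (+ 1))) k+1<x)
      (<-respʳ-≈ (trans (+-congˡ (fromℕ-+ 1 s)) (trans (sym (+-assoc (fromℤ k) (fromℕ 1) (fromℕ s))) (+-congʳ (sym (fromℤ-+ k (+ 1)))))) x<k+s)

-- The golden ratio obtained from √5.

module √5⇒GoldenRatio {c ℓ₁ ℓ₂ ℓ₃} (ℝ : RealNumbers c ℓ₁ ℓ₂ ℓ₃) where
  open OrderedField ℝ
  open Division ℝ

  module _ (√5 : Carrier) (0<√5 : 0# < √5) (√5²≈5 : √5 * √5 ≈ fromℕ 5) where

    φ v : Carrier
    φ = (fromℕ 1 + √5) / 2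
    v = 1# + fromℕ 2 ÷ √5 [ 0<√5 ]

    2φ≈ : fromℕ 2 * φ ≈ fromℕ 1 + √5
    2φ≈ = ÷-cancel (fromℕ 1 + √5) (fromℕ 2) (0<fromℕ 2)

    0<φ : 0# < φ
    0<φ = 0<-cancelˡ (0<fromℕ 2) (<-respʳ-≈ (sym 2φ≈) (0<fromℕ 1 +⁺⁺ 0<√5))

    √5≈ : √5 ≈ fromℕ 2 * φ - fromℕ 1
    √5≈ = trans (solve 1 (λ s → s := con (+ 1) :+ s :- con (+ 1)) refl √5) (+-congʳ (sym 2φ≈))

    φ²≈ : φ * φ ≈ φ + fromℕ 1
    φ²≈ = ≈-cancelˡ (0<fromℕ 4) (modulo {k = fromℕ 1} (trans (sym (*-cong √5≈ √5≈)) √5²≈5)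
      (solve 1 (λ φ → con (+ 4) :* (φ :* φ) := con (+ 4) :* (φ :+ con (+ 1)) :+ con (+ 1) :* ((con (+ 2) :* φ :- con (+ 1)) :* (con (+ 2) :* φ :- con (+ 1)) :- con (+ 5))) refl φ))

    -- (5 √5)² − 11² = 4
    8<5φ : fromℕ 8 < fromℕ 5 * φ
    8<5φ = 0<⇒< refl (0<-cancelˡ (0<fromℕ 2 *⁺⁺ (0<fromℕ 5 *⁺⁺ 0<√5 +⁺⁺ 0<fromℕ 11)) (<-respʳ-≈
      (sym (modulo {k = fromℕ 5 * (fromℕ 5 * √5 + fromℕ 11)} 2φ≈ (modulo {k = fromℕ 25} √5²≈5
        (solve 2 (λ s φ → con (+ 2) :* (con (+ 5) :* s :+ con (+ 11)) :* (con (+ 5) :* φ :- con (+ 8))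
          := con (+ 4) :+ con (+ 5) :* (con (+ 5) :* s :+ con (+ 11)) :* (con (+ 2) :* φ :- (con (+ 1) :+ s)) :+ con (+ 25) :* (s :* s :- con (+ 5))) refl √5 φ))))
      (0<fromℕ 4)))

    -- 9² − (4 √5)² = 1
    8φ<13 : fromℕ 8 * φ < fromℕ 13
    8φ<13 = 0<⇒< refl (0<-cancelˡ (0<fromℕ 9 +⁺⁺ 0<fromℕ 4 *⁺⁺ 0<√5) (<-respʳ-≈
      (sym (modulo {k = - (fromℕ 4 * (fromℕ 9 + fromℕ 4 * √5))} 2φ≈ (modulo {k = - fromℕ 16} √5²≈5
        (solve 2 (λ s φ → (con (+ 9) :+ con (+ 4) :* s) :* (con (+ 13) :- con (+ 8) :* φ)
          := con (+ 1) :+ (:- (con (+ 4) :* (con (+ 9) :+ con (+ 4) :* s))) :* (con (+ 2) :* φ :- (con (+ 1) :+ s)) :+ (:- con (+ 16)) :* (s :* s :- con (+ 5))) refl √5 φ))))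
      (0<fromℕ 1)))

    v≈ : (fromℕ 2 * φ - fromℕ 1) * v ≈ fromℕ 2 * φ + fromℕ 1
    v≈ = begin
      (fromℕ 2 * φ - fromℕ 1) * v                ≈⟨ *-congʳ √5≈ ⟨
      √5 * (1# + fromℕ 2 ÷ √5 [ 0<√5 ])          ≈⟨ distribˡ √5 1# _ ⟩
      √5 * 1# + √5 * (fromℕ 2 ÷ √5 [ 0<√5 ])     ≈⟨ +-cong (*-identityʳ √5) (÷-cancel (fromℕ 2) √5 0<√5) ⟩
      √5 + fromℕ 2                               ≈⟨ +-congʳ √5≈ ⟩
      fromℕ 2 * φ - fromℕ 1 + fromℕ 2            ≈⟨ solve 1 (λ φ → con (+ 2) :* φ :- con (+ 1) :+ con (+ 2) := con (+ 2) :* φ :+ con (+ 1)) refl φ ⟩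
      fromℕ 2 * φ + fromℕ 1                      ∎
      where open import Relation.Binary.Reasoning.Setoid setoid

    goldenRatio : GoldenRatio ℝ
    goldenRatio = record
      { φ     = φ
      ; 0<φ   = 0<φ
      ; φ²≈   = φ²≈
      ; 8<5φ  = 8<5φ
      ; 8φ<13 = 8φ<13
      ; √5    = √5
      ; √5≈   = √5≈
      ; v     = v
      ; v≈    = v≈
      }

-- The classification modulo 1.

module Conclusion {c ℓ₁ ℓ₂ ℓ₃} (ℝ : RealNumbers c ℓ₁ ℓ₂ ℓ₃) (G : GoldenRatio ℝ) where
  open OrderedField ℝ
  open GoldenRatio G
  open LargestGap ℝ
  open Nodes ℝ
  open Location ℝ
  open Division ℝ
  open Certificates ℝ G

  quotient-Is : ∀ {x} A B C .{{_ : NonZero C}} → x ≈ fromℤ A + fromℤ B * φ → (x / C) Is (A , B , C)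
  quotient-Is {x} A B C x≈ = 0<fromℕ C , trans (÷-cancel x (fromℕ C) (0<fromℕ C)) x≈

  plus-√5 : ∀ a → fromℕ (suc a) + √5 ≈ fromℤ (+ a) + fromℕ 2 * φ
  plus-√5 a = trans (+-cong (fromℕ-+ 1 a) √5≈) (solve 2 (λ a φ → con (+ 1) :+ a :+ (con (+ 2) :* φ :- con (+ 1)) := a :+ con (+ 2) :* φ) refl (fromℕ a) φ)

  minus-√5 : ∀ a → fromℕ a - √5 ≈ fromℤ (+ suc a) + fromℤ (ℤ.- + 2) * φ
  minus-√5 a = trans (+-congˡ (-‿cong √5≈)) (trans (solve 2 (λ a φ → a :- (con (+ 2) :* φ :- con (+ 1)) := (con (+ 1) :+ a) :+ con (ℤ.- + 2) :* φ) refl (fromℕ a) φ)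
    (+-congʳ (sym (fromℕ-+ 1 a))))

  η-Is : ∀ i → η √5 i Is ηSurd i
  η-Is 0F = quotient-Is (+ 12) (+ 2) 82 (plus-√5 12)
  η-Is 1F = quotient-Is (+ 8) (ℤ.- + 2) 22 (minus-√5 7)
  η-Is 2F = quotient-Is (+ 10) (+ 2) 58 (plus-√5 10)
  η-Is 3F = quotient-Is (+ 6) (ℤ.- + 2) 10 (minus-√5 5)
  η-Is 4F = quotient-Is (+ 8) (+ 2) 38 (plus-√5 8)
  η-Is 5F = quotient-Is (+ 26) (ℤ.- + 2) 62 (minus-√5 25)
  η-Is 6F = quotient-Is (+ 4) (ℤ.- + 2) 2 (minus-√5 3)
  η-Is 7F = quotient-Is (+ 6) (+ 2) 22 (plus-√5 6)

  1-Is : ∀ {θ} S → θ Is S → (1# - θ) Is 1-surd S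
  1-Is {θ} (A , B , C) (0<C , Cθ≈) = 0<C , (begin
    fromℕ C * (1# - θ)                            ≈⟨ *-congˡ (+-congʳ fromℕ-1) ⟨
    fromℕ C * (fromℕ 1 - θ)                       ≈⟨ solve 2 (λ C θ → C :* (con (+ 1) :- θ) := C :- C :* θ) refl (fromℕ C) θ ⟩
    fromℕ C - fromℕ C * θ                         ≈⟨ +-congˡ (-‿cong Cθ≈) ⟩
    fromℕ C - (fromℤ A + fromℤ B * φ)             ≈⟨ solve 4 (λ A B C φ → C :- (A :+ B :* φ) := (C :- A) :+ (:- B) :* φ) refl (fromℤ A) (fromℤ B) (fromℕ C) φ ⟩
    (fromℕ C - fromℤ A) + (- fromℤ B) * φ
      ≈⟨ +-cong (trans (fromℤ-+ (+ C) (ℤ.- A)) (+-congˡ (fromℤ-neg A))) (*-congʳ (fromℤ-neg B)) ⟨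
    fromℤ (+ C ℤ.- A) + fromℤ (ℤ.- B) * φ         ∎)
    where open import Relation.Binary.Reasoning.Setoid setoid

  ext : Fin 16 → Carrier
  ext = extremal √5

  extremal-Is : ∀ j → ext j Is extremalSurd j
  extremal-Is j with splitAt 8 j
  ... | inj₁ i = η-Is i
  ... | inj₂ i = 1-Is (ηSurd i) (η-Is i)

  0<extremal : ∀ j → 0# < ext j
  0<extremal j = above-sound (extremalSurd j) (+ 0 , + 0 , 1) (extremal-Is j)
    (0<fromℕ 1 , solve 1 (λ φ → con (+ 1) :* con (+ 0) := con (+ 0) :+ con (+ 0) :* φ) refl φ) (extremal-positive j)

  nine-tenths : Carrier
  nine-tenths = fromℕ 9 / 10

  nine-tenths-Is : nine-tenths Is (+ 9 , + 0 , 10)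
  nine-tenths-Is = quotient-Is (+ 9) (+ 0) 10 (solve 1 (λ φ → con (+ 9) := con (+ 9) :+ con (+ 0) :* φ) refl φ)

  nine-tenths<1 : nine-tenths < fromℕ 1
  nine-tenths<1 = above-sound (+ 1 , + 0 , 1) (+ 9 , + 0 , 10)
    (0<fromℕ 1 , solve 1 (λ φ → con (+ 1) :* con (+ 1) := con (+ 1) :+ con (+ 0) :* φ) refl φ) nine-tenths-Is tt

  extremal<nine-tenths : ∀ j → ext j < nine-tenths
  extremal<nine-tenths j = above-sound (+ 9 , + 0 , 10) (extremalSurd j) nine-tenths-Is (extremal-Is j) (extremal<9/10 j)

  extremal-apart : ∀ i j → i ≢ j → ext i # ext j
  extremal-apart i j i≢j = decide (∨-elim ⌊ i Finₚ.≟ j ⌋ (extremal-separated i j))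
    where
    order : T (above (extremalSurd i) (extremalSurd j)) ⊎ T (above (extremalSurd j) (extremalSurd i)) → ext i # ext j
    order (inj₁ i>j) = #-sym (<⇒# (above-sound (extremalSurd i) (extremalSurd j) (extremal-Is i) (extremal-Is j) i>j))
    order (inj₂ j>i) = <⇒# (above-sound (extremalSurd j) (extremalSurd i) (extremal-Is j) (extremal-Is i) j>i)
    decide : T ⌊ i Finₚ.≟ j ⌋ ⊎ T (above (extremalSurd i) (extremalSurd j) ∨ above (extremalSurd j) (extremalSurd i)) → ext i # ext j
    decide (inj₁ i≡j) = ⊥-elim (i≢j (toWitness {a? = i Finₚ.≟ j} i≡j))
    decide (inj₂ t)   = order (∨-elim (above (extremalSurd i) (extremalSurd j)) t)

  UpperBound-shift : ∀ {θ θ' k u} → θ ≈ θ' + fromℤ k → UpperBound θ u → UpperBound θ' u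
  UpperBound-shift {θ} {θ'} {k} θ≈ bound 1≤m isd = bound 1≤m (Is-d-shift {k = ℤ.- k} (shift-back {k = k} θ≈) isd)

  rootPair : ∀ θ → FareyPair θ 0 1 1 1 θ (fromℕ 1 - θ)
  rootPair θ = record
    { 1≤q  = s≤s z≤n
    ; 1≤q' = s≤s z≤n
    ; det  = solve 0 (con (+ 1) :* con (+ 1) :- con (+ 0) :* con (+ 1) := con (+ 1)) refl
    ; δ≈   = solve 1 (λ θ → θ := con (+ 1) :* θ :- con (+ 0)) refl θ
    ; δ'≈  = solve 1 (λ θ → con (+ 1) :- θ := con (+ 1) :- con (+ 1) :* θ) refl θ
    }

  extremal-complete : ∀ {θ} → UpperBound θ v → 0# ≤ θ → θ < fromℕ 1 → (∀ j → ¬ θ ≈ ext j) → ⊥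
  extremal-complete {θ} bound 0≤θ θ<1 none = compare {0#} {θ}
    (λ 0<θ → search-sound bound table (Allₚ.tabulate⁺ {f = extremalSurd} λ j → proj₁ (extremal-Is j) , λ is → none j (Is-unique {surd = extremalSurd j} is (extremal-Is j)))
      10 [] (node (rootPair θ) 0<θ (<⇒0< θ<1)) [] search-succeeds)
    (λ 0≈θ → rational-unbounded (rootPair θ) (sym 0≈θ) (<⇒0< θ<1) ℕₚ.≤-refl bound)
    0≤θ

  extremal-Extremal : ∀ j → Extremal (ext j) 1 1 (ext j) (fromℕ 1 - ext j)
  extremal-Extremal j = walk-sound {A = proj₁ S} {proj₁ (proj₂ S)} {proj₂ (proj₂ S)} (extremal-Is j) 6 (rootPair (ext j)) (walk-succeeds j)
    where S = extremalSurd j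

  Is-D⇒UpperBound : ∀ {θ} → Is-D θ v → UpperBound θ v
  Is-D⇒UpperBound (bound , _) {m} {d} 1≤m isd = bound _ (m , d , 1≤m , isd , sym (fromℕ-· (suc m) d))

  Is-D⇒extremal : ∀ {θ} → Is-D θ v → ∃[ j ] θ ≈₁ ext j
  -- Comparing θ with k + 9/10 < k + 1 fixes the integer part: above k + 9/10, θ - k is too large to
  -- be extremal; below k + 1, θ - k - 1 is negative.
  Is-D⇒extremal {θ} isD = by-cases (<-cotrans (0<⇒< (solve 3 (λ k a o → o :- a := k :+ o :- (k :+ a)) refl (fromℤ k) nine-tenths (fromℕ 1)) (<⇒0< nine-tenths<1)) θ)
    where
    k : ℤ
    k = proj₁ (locate θ)
    k<θ : fromℤ k < θ
    k<θ = proj₁ (proj₂ (locate θ))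
    θ<k+2 : θ < fromℤ k + fromℕ 2
    θ<k+2 = proj₂ (proj₂ (locate θ))
    unshift : ∀ i → θ ≈ (θ - fromℤ i) + fromℤ i
    unshift i = solve 2 (λ θ i → θ := θ :- i :+ i) refl θ (fromℤ i)
    bound : ∀ i → UpperBound (θ - fromℤ i) v
    bound i = UpperBound-shift {k = i} (unshift i) (Is-D⇒UpperBound isD)
    k+1≈ : fromℤ (k ℤ.+ + 1) ≈ fromℤ k + fromℕ 1
    k+1≈ = fromℤ-+ k (+ 1)

    classical : (∀ j → ¬ θ - fromℤ k ≈ ext j) → (∀ j → ¬ θ - fromℤ (k ℤ.+ + 1) ≈ ext j) → ⊥
    classical none none' = lower λ θ<k+1 → extremal-complete (bound k) (<⇒≤ (<⇒0< k<θ))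
        (0<⇒< (solve 2 (λ θ k → k :+ con (+ 1) :- θ := con (+ 1) :- (θ :- k)) refl θ (fromℤ k)) (<⇒0< θ<k+1)) none
      where
      lower : fromℤ k + fromℕ 1 ≤ θ → ⊥
      lower k+1≤θ = extremal-complete (bound (k ℤ.+ + 1)) (≤-respʳ-≈ (+-congˡ (-‿cong (sym k+1≈))) (≤⇒0≤ k+1≤θ))
        (0<⇒< (trans (solve 2 (λ θ k → k :+ con (+ 2) :- θ := con (+ 1) :- (θ :- (k :+ con (+ 1)))) refl θ (fromℤ k)) (+-congˡ (-‿cong (+-congˡ (-‿cong (sym k+1≈))))))
          (<⇒0< θ<k+2)) none'

    finish : ∀ i → ¬ (∀ j → ¬ θ - fromℤ i ≈ ext j) → ∃[ j ] θ ≈₁ ext j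
    finish i ¬¬∃ = let (j , θ-i≈) = select 15 ext extremal-apart ¬¬∃ in j , i , trans (unshift i) (+-congʳ θ-i≈)

    by-cases : fromℤ k + nine-tenths < θ ⊎ θ < fromℤ k + fromℕ 1 → ∃[ j ] θ ≈₁ ext j
    by-cases (inj₂ θ<k+1) = finish k λ none → classical none λ j θ-k-1≈ → absurd
      (<⇒0< θ<k+1 +⁺⁺ 0<extremal j)
      (trans (+-congˡ (trans (sym θ-k-1≈) (+-congˡ (-‿cong k+1≈))))
        (solve 2 (λ θ k → (k :+ con (+ 1) :- θ) :+ (θ :- (k :+ con (+ 1))) := con (+ 0)) refl θ (fromℤ k)))
    by-cases (inj₁ θ>) = finish (k ℤ.+ + 1) λ none' → classical (λ j θ-k≈ → absurd
      (<⇒0< θ> +⁺⁺ <⇒0< (extremal<nine-tenths j))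
      (trans (+-congˡ (+-congˡ (-‿cong (sym θ-k≈))))
        (solve 3 (λ θ k a → (θ :- (k :+ a)) :+ (a :- (θ :- k)) := con (+ 0)) refl θ (fromℤ k) nine-tenths))) none'

  extremal⇒Is-D : ∀ {θ} → ∃[ j ] θ ≈₁ ext j → Is-D θ v
  extremal⇒Is-D {θ} (j , k , θ≈) = upper , least
    where
    open Extremal (extremal-Extremal j)
    upper : ∀ x → ScaledValue θ x → x ≤ v
    upper x (m , d , 1≤m , (_ , d-least) , x≈) = ≤-respˡ-≈ (sym (trans x≈ (fromℕ-· (suc m) d))) md≤v
      where
      -- The quotient v / (m + 1) bounds every avoiding interval, hence also the given supremum `d`.
      1/m : ∃[ y ] 0# < y × fromℕ (suc m) * y ≈ fromℕ 1
      1/m = inverse (0<fromℕ (suc m))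
      y = proj₁ 1/m
      my≈1 : fromℕ (suc m) * y ≈ fromℕ 1
      my≈1 = proj₂ (proj₂ 1/m)
      d≤ : d ≤ v * y
      d≤ = d-least (v * y) λ l (I , avoids , l≈) → ≤-respˡ-≈ (sym l≈) (0≤⇒≤
        (modulo {k = - ∣ I ∣} my≈1 (solve 4 (λ y M v l → y :* (v :- M :* l) := v :* y :- l :+ (:- l) :* (M :* y :- con (+ 1))) refl y (fromℕ (suc m)) v ∣ I ∣))
        (<⇒≤ (proj₁ (proj₂ 1/m)) *⁰⁰ ≤⇒0≤ (bounded {m} {I} (s≤s z≤n) (s≤s z≤n) (Avoids-shift {k = k} {I = I} θ≈ avoids))))
      md≤v : fromℕ (suc m) * d ≤ v
      md≤v = 0≤⇒≤ (modulo {k = v} my≈1 (solve 4 (λ y M v d → M :* (v :* y :- d) := v :- M :* d :+ v :* (M :* y :- con (+ 1))) refl y (fromℕ (suc m)) v d))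
        (0≤fromℕ (suc m) *⁰⁰ ≤⇒0≤ d≤)
    least : ∀ u → IsUpperBound (ScaledValue θ) u → v ≤ u
    least u u-bound = sup (UpperBound-shift {k = k} θ≈ λ {m} {d} 1≤m isd → u-bound _ (m , d , 1≤m , isd , sym (fromℕ-· (suc m) d)))

  -- All sixteen numbers lie between 0 and 9/10, so an integer difference of two of them is 0, and
  -- distinct indices give numbers that are apart.
  extremal-injective : Injective _≡_ _≈₁_ ext
  extremal-injective {i} {j} (k , i≈j+k) = decidable-stable (i Finₚ.≟ j) λ i≢j → cases i≢j (fromℤ-dichotomy k) (fromℤ-dichotomy (ℤ.- k))
    where
    cases : i ≢ j → fromℤ k ≤ 0# ⊎ fromℕ 1 ≤ fromℤ k → fromℤ (ℤ.- k) ≤ 0# ⊎ fromℕ 1 ≤ fromℤ (ℤ.- k) → ⊥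
    cases i≢j (inj₂ 1≤k) _ = absurd
      (<⇒0< (extremal<nine-tenths i) +⁺⁺ <⇒0< nine-tenths<1 +⁺⁰ ≤⇒0≤ 1≤k +⁺⁰ <⇒≤ (0<extremal j))
      (trans (+-congʳ (+-congʳ (+-congʳ (+-congˡ (-‿cong i≈j+k)))))
        (solve 3 (λ a j k → (a :- (j :+ k)) :+ (con (+ 1) :- a) :+ (k :- con (+ 1)) :+ j := con (+ 0)) refl nine-tenths (ext j) (fromℤ k)))
    cases i≢j _ (inj₂ 1≤-k) = absurd
      (<⇒0< (extremal<nine-tenths j) +⁺⁺ <⇒0< nine-tenths<1 +⁺⁰ ≤⇒0≤ (≤-respʳ-≈ (fromℤ-neg k) 1≤-k) +⁺⁰ <⇒≤ (0<extremal i))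
      (trans (+-congˡ i≈j+k)
        (solve 3 (λ a j k → (a :- j) :+ (con (+ 1) :- a) :+ (:- k :- con (+ 1)) :+ (j :+ k) := con (+ 0)) refl nine-tenths (ext j) (fromℤ k)))
    cases i≢j (inj₁ k≤0) (inj₁ -k≤0) = #-irrefl (trans i≈j+k (trans (+-congˡ k≈0) (+-identityʳ _))) (extremal-apart i j i≢j)
      where
      k≈0 : fromℤ k ≈ 0#
      k≈0 = ≤∧≥⇒≈ k≤0 (0≤⇒≤ (solve 1 (λ k → con (+ 0) :- :- k := k :- con (+ 0)) refl (fromℤ k)) (≤⇒0≤ (≤-respˡ-≈ (fromℤ-neg k) -k≤0)))

mainTheorem2 :
    ∀ {c ℓ₁ ℓ₂ ℓ₃} (ℝ : RealNumbers c ℓ₁ ℓ₂ ℓ₃) →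
    let open RealNumbers ℝ
        open Dispersion ℝ
    in
    (√5 : Carrier) (0<√5 : 0# < √5) → √5 * √5 ≈ fromℕ 5 →
    (∀ θ → Is-D θ (1# + fromℕ 2 ÷ √5 [ 0<√5 ]) ⇔ (∃[ j ] θ ≈₁ extremal √5 j))
    × Injective _≡_ _≈₁_ (extremal √5)
mainTheorem2 ℝ √5 0<√5 √5²≈5 = (λ θ → mk⇔ Is-D⇒extremal extremal⇒Is-D) , extremal-injective
  where
  open √5⇒GoldenRatio ℝ
  open Conclusion ℝ (goldenRatio √5 0<√5 √5²≈5)
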